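{- Let $p$ be an odd prime and let $c,d$ be integers. For integers $a,b$ let $D_p(a,b)=\left[(i^2+aij+bj^2)^{p-2}\right]_{1\le i,j\le p-1}$ and $D_p(a)=D_p(a,1)$. Suppose $p\nmid\det D_p(c)$. Then the following results hold. (1) If $\left(\frac{c^2-4}{p}\right)=1$, then $$\left(\frac{\det D_p(c)}{p}\right)=\left(\frac{ -c-2}{p}\right)^{(p-1)/2}.$$ (2) If $\left(\frac{c^2-4}{p}\right)=-1$, then $$\left(\frac{\det D_p(c)}{p}\right)=\left(\frac{ -c-2}{p}\right)^{(p-1)/2}\left(\frac{2c}{p}\right).$$ (3) When $p\nmid d$, we have $$\left(\frac{\det D_p(c,d^2)}{p}\right)=\left(\frac{d}{p}\right)^{(p-1)/2}\left(\frac{\det D_p(cd^{ -1})}{p}\right),$$ where $d^{ -1}$ denotes an integer that is an inverse of $d$ modulo $p$.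
   Context: $\left(\frac{\cdot}{p}\right)$ denotes the Legendre symbol modulo $p$ (with value $0$ on multiples of $p$). For integers $a,b$, $D_p(a,b)$ is the $(p-1)\times(p-1)$ integer matrix whose $(i,j)$ entry is $(i^2+aij+bj^2)^{p-2}$, $1\le i,j\le p-1$. The residue of $\det D_p(a,b)$ modulo $p$ depends only on $a,b$ modulo $p$, so the choice of inverse $d^{ -1}$ does not matter. -}

module Defs where

open import Data.Bool.Base using (if_then_else_)
open import Data.Fin.Base using (Fin; zero; suc; toℕ; punchIn)
open import Data.Fin.Properties using (any?)
open import Data.Integer.Base using (ℤ; +_; 0ℤ; 1ℤ; -1ℤ; _+_; _-_; _*_; _^_)
open import Data.Integer.Divisibility.Signed using (_∣_; _∣?_)
open import Data.Integer.Properties using (+-0-commutativeMonoid)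
open import Data.Nat.Base as ℕ using (ℕ; _∸_)
open import Data.Product.Base using (∃)
open import Data.Vec.Functional using (Vector)
open import Relation.Nullary.Decidable using (Dec; does)

open import Algebra.Properties.CommutativeMonoid.Sum +-0-commutativeMonoid
  using (sum)

Matrix : ℕ → Set
Matrix n = Vector (Vector ℤ n) n

-- Cofactor expansion along the first row.  Indices count from 0, so the
-- sign of the j-th cofactor is (-1)^j.
det : ∀ {n} → Matrix n → ℤ
det {ℕ.zero}  A = 1ℤ
det {ℕ.suc n} A = sum λ j →
  -1ℤ ^ toℕ j * A zero j * det (λ i k → A (suc i) (punchIn j k))

infix 4 _≡_[mod_]

_≡_[mod_] : ℤ → ℤ → ℕ → Set
x ≡ y [mod m ] = + m ∣ x - y

-- Solvability of x² ≡ a (mod p).  Whether x is a solution depends only on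
-- x modulo p, so x ranges over the representatives 0, …, p - 1.
IsSquareMod : ℕ → ℤ → Set
IsSquareMod p a = ∃ λ (x : Fin p) → (+ toℕ x) ^ 2 ≡ a [mod p ]

isSquareMod? : ∀ p a → Dec (IsSquareMod p a)
isSquareMod? p a = any? λ x → + p ∣? (+ toℕ x) ^ 2 - a

legendre : ℕ → ℤ → ℤ
legendre p a =
  if does (+ p ∣? a)         then 0ℤ  else
  if does (isSquareMod? p a) then 1ℤ  else
                                  -1ℤ

-- The index i : Fin (p ∸ 1) stands for the row (or column) number 1 + i.
D : (p : ℕ) → ℤ → ℤ → Matrix (p ∸ 1)
D p a b i j = (x ^ 2 + a * x * y + b * y ^ 2) ^ (p ∸ 2)
  where
  x y : ℤ
  x = + ℕ.suc (toℕ i)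
  y = + ℕ.suc (toℕ j)

{-# OPTIONS --safe #-}

-- Let n = (p - 1) / 2 and T m = Σₜ (t² + a t + b)^(p-2) t^(m+1) over ℤ/p.  As the
-- (i, j) entry of D_p(a, b) is homogeneous in i and j, characters of the
-- multiplicative group diagonalise the matrix: D ≡ V · diag (-T) · W with
-- V i m = i^(p-2-m) and W m j = j^(p-2+m), where V · W is diagonal, so that
-- det D is a nonzero square times Πₘ T m.  For b = 1 the substitution t ↦ t⁻¹
-- gives T m = T (p - 1 - m), and only T 0 · T n matters up to squares.
-- With κ = Σₛ sⁿ (s + 1)^(p-2), completing the square in T 0 and grouping T n by
-- the values of t + t⁻¹ yields
--   2 · 4^(p-2) T 0 = - a κ (4 - a²)^(n-1),   T n = κ ((a - 2)^(n-1) + (a + 2)^(n-1)).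
-- Substituting t ↦ d t relates the sums T for b = d² to those for b = 1.

module Submission where

open import Defs
open import Algebra.Bundles using (CommutativeRing)
open import Data.Bool.Base using (if_then_else_)
open import Data.Empty using (⊥-elim)
open import Data.Fin.Base using (Fin; zero; suc; toℕ; fromℕ<; punchIn; punchOut)
open import Data.Fin.Permutation using (Permutation; permutation; _⟨$⟩ʳ_)
open import Data.Fin.Properties
  using (any?; toℕ<n; toℕ-fromℕ<; toℕ-injective; suc-injective; punchInᵢ≢i; punchOut-injective;
         <⇒notInjective; ¬∀⟶∃¬)
open import Data.Integer.Base using (ℤ; +_; 0ℤ; 1ℤ; -1ℤ; -_; _+_; _-_; _*_; _^_; ∣_∣)
open import Data.Integer.DivMod using (_%ℕ_; _/ℕ_; n%ℕd<d; a≡a%ℕn+[a/ℕn]*n)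
open import Data.Integer.Divisibility.Signed
  using (_∣_; divides; _∣?_; ∣-refl; ∣ᵤ⇒∣; ∣⇒∣ᵤ; ∣m∣n⇒∣m+n; ∣m⇒∣-m; ∣n⇒∣m*n; ∣m⇒∣m*n)
open import Data.Integer.Properties as ℤ using (+-*-commutativeRing)
open import Data.Integer.Tactic.RingSolver using (solve-∀)
open import Data.Nat.Base as ℕ using (ℕ; suc; _∸_; s≤s)
open import Data.Nat.DivMod using (_/_; _%_; m≡m%n+[m/n]*n; m%n<n; m*n/n≡m)
open import Data.Nat.Divisibility using (>⇒∤; m%n≡0⇒n∣m) renaming (_∣_ to _∣ₙ_)
open import Data.Nat.Primality using (Prime; ¬prime[1]; euclidsLemma)
import Data.Nat.Properties as ℕ
open import Data.Product.Base using (_×_; _,_; ∃; proj₁; proj₂)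
open import Data.Sum.Base using (_⊎_; inj₁; inj₂; [_,_]′)
open import Data.Unit.Base using (⊤)
open import Data.Vec.Base using (Vec; []; _∷_; map; lookup; tabulate)
open import Data.Vec.Functional using (Vector)
open import Data.Vec.Properties using (lookup-map; lookup∘tabulate)
open import Data.Vec.Relation.Binary.Pointwise.Inductive using (Pointwise; []; _∷_)
open import Function.Base using (_∘_; id)
open import Relation.Binary.PropositionalEquality
  using (_≡_; _≗_; refl; sym; trans; cong; cong₂; subst; module ≡-Reasoning)
open import Relation.Nullary using (¬_; Dec; yes; no)
open import Relation.Nullary.Decidable using (map′; does; dec-true; dec-false)

-- Modulo p, `x ^ (p ∸ 2)` is the inverse of x, with 0 sent to 0. Euler's criterion turns every
-- Legendre symbol into an n-th power, which forgets nonzero square factors. The hypothesis on det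
-- makes each discarded factor nonzero, including κ, which occurs in T 0 · T n only as κ². With α =
-- c - 2 and β = c + 2, so that α β = c² - 4, the product T 0 · T n contributes - c (α^n β + β^n α).
-- The symbol of c² - 4 decides whether α^n and β^n agree or are opposite. If they agree, α + β = 2
-- c completes a square c². If they are opposite, β - α = 4 leaves a single c, the source of the
-- factor (2c / p) in (2). As det is a cofactor expansion, the factorisation rests on
-- multiplicativity, obtained here from the uniqueness of alternating forms. The matrix W serves a
-- second time: det W ≠ 0 modulo p shows that for 0 < m < p - 1 the m-th power is not constantly 1
-- on nonzero residues. This yields the power sums, and from them Euler's criterion, in place of a
-- primitive root.

module Determinant where
  open import Algebra.Properties.Semiring.Sum (CommutativeRing.semiring +-*-commutativeRing)
    using (sum; sum-cong-≗; sum-remove; ∑-distrib-+; *-distribˡ-sum; sum-replicate-zero)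

  private variable
    m n n′ : ℕ

  -- Finite sums, the standard basis and linear functionals

  sum-zero : ∀ {t : Vector ℤ n} → (∀ i → t i ≡ 0ℤ) → sum t ≡ 0ℤ
  sum-zero {n = n} t≡0 = trans (sum-cong-≗ t≡0) (sum-replicate-zero n)

  e : Fin n → Vector ℤ n
  e zero    zero    = 1ℤ
  e zero    (suc j) = 0ℤ
  e (suc i) zero    = 0ℤ
  e (suc i) (suc j) = e i j

  e-sym : ∀ (i j : Fin n) → e i j ≡ e j i
  e-sym zero    zero    = refl
  e-sym zero    (suc j) = refl
  e-sym (suc i) zero    = refl
  e-sym (suc i) (suc j) = e-sym i j

  e-sum : ∀ (i : Fin n) (w : Vector ℤ n) → sum (λ j → e i j * w j) ≡ w i
  e-sum zero    w = trans (cong (λ s → 1ℤ * w zero + s) (sum-zero λ j → ℤ.*-zeroˡ (w (suc j)))) (lem (w zero))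
    where
    lem : ∀ x → 1ℤ * x + 0ℤ ≡ x
    lem = solve-∀
  e-sum (suc i) w = trans (cong₂ _+_ (ℤ.*-zeroˡ (w zero)) (e-sum i (w ∘ suc))) (ℤ.+-identityˡ _)

  sum-e : ∀ (v : Vector ℤ n) i → sum (λ j → v j * e j i) ≡ v i
  sum-e v i = trans (sum-cong-≗ λ j → trans (ℤ.*-comm (v j) _) (cong (_* v j) (e-sym j i))) (e-sum i v)

  -- Vectors are functions compared pointwise, hence the field `resp`. The single law `comb` packs
  -- additivity and homogeneity; c = -1 recovers the value 0 at the zero vector.
  record Linear (g : Vector ℤ n → ℤ) : Set where
    field
      resp : ∀ {u v} → u ≗ v → g u ≡ g v
      comb : ∀ u c v → g (λ i → u i + c * v i) ≡ g u + c * g v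

    zero-vec : ∀ {u} → (∀ i → u i ≡ 0ℤ) → g u ≡ 0ℤ
    zero-vec {u} u≡0 = begin
      g u                           ≡⟨ resp (λ i → trans (u≡0 i) (sym (lem (u i)))) ⟩
      g (λ i → u i + -1ℤ * u i)     ≡⟨ comb u -1ℤ u ⟩
      g u + -1ℤ * g u               ≡⟨ lem (g u) ⟩
      0ℤ                            ∎
      where
      open ≡-Reasoning
      lem : ∀ x → x + -1ℤ * x ≡ 0ℤ
      lem = solve-∀

    on-sum : ∀ (c : Fin m → ℤ) (w : Fin m → Vector ℤ n) →
             g (λ i → sum λ j → c j * w j i) ≡ sum λ j → c j * g (w j)
    on-sum {m = ℕ.zero}  c w = zero-vec λ _ → refl
    on-sum {m = ℕ.suc m} c w = begin
      g (λ i → c zero * w zero i + sum λ j → c (suc j) * w (suc j) i)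
        ≡⟨ resp (λ i → ℤ.+-comm (c zero * w zero i) _) ⟩
      g (λ i → sum (λ j → c (suc j) * w (suc j) i) + c zero * w zero i)
        ≡⟨ comb _ (c zero) (w zero) ⟩
      g (λ i → sum (λ j → c (suc j) * w (suc j) i)) + c zero * g (w zero)
        ≡⟨ cong (_+ c zero * g (w zero)) (on-sum (c ∘ suc) (w ∘ suc)) ⟩
      sum (λ j → c (suc j) * g (w (suc j))) + c zero * g (w zero)
        ≡⟨ ℤ.+-comm _ (c zero * g (w zero)) ⟩
      c zero * g (w zero) + sum (λ j → c (suc j) * g (w (suc j)))
        ∎
      where open ≡-Reasoning

    on-basis : ∀ v → g v ≡ sum λ j → v j * g (e j)
    on-basis v = trans (resp λ i → sym (sum-e v i)) (on-sum v e)

  open Linear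

  LinearMap : (Vector ℤ n → Vector ℤ n′) → Set
  LinearMap L = ∀ i → Linear λ v → L v i

  Linear-∘ : {g : Vector ℤ n′ → ℤ} {L : Vector ℤ n → Vector ℤ n′} →
             Linear g → LinearMap L → Linear (g ∘ L)
  Linear-∘ g L .resp u≗v      = g .resp λ i → L i .resp u≗v
  Linear-∘ g L .comb u c v = trans (g .resp λ i → L i .comb u c v) (g .comb _ c _)

  Linear-coordinate : ∀ (i : Fin n) → Linear λ v → v i
  Linear-coordinate i .resp u≗v    = u≗v i
  Linear-coordinate i .comb u c v = refl

  Linear-sum : ∀ {G : Fin m → Vector ℤ n → ℤ} (c : Fin m → ℤ) →
               (∀ j → Linear (G j)) → Linear λ v → sum λ j → c j * G j v
  Linear-sum c G .resp u≗v = sum-cong-≗ λ j → cong (c j *_) (G j .resp u≗v)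
  Linear-sum {G = F} c G .comb u a v = begin
    sum (λ j → c j * F j (λ i → u i + a * v i))
      ≡⟨ sum-cong-≗ (λ j → trans (cong (c j *_) (G j .comb u a v)) (lem (c j) (F j u) a (F j v))) ⟩
    sum (λ j → c j * F j u + a * (c j * F j v))
      ≡⟨ ∑-distrib-+ (λ j → c j * F j u) (λ j → a * (c j * F j v)) ⟩
    sum (λ j → c j * F j u) + sum (λ j → a * (c j * F j v))
      ≡⟨ cong (_+_ (sum (λ j → c j * F j u))) (*-distribˡ-sum a (λ j → c j * F j v)) ⟨
    sum (λ j → c j * F j u) + a * sum (λ j → c j * F j v)
      ∎
    where
    open ≡-Reasoning
    lem : ∀ c x a y → c * (x + a * y) ≡ c * x + a * (c * y)
    lem = solve-∀

  infixl 7 _·_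

  _·_ : Vector ℤ m → (Fin m → Vector ℤ n) → Vector ℤ n
  (v · B) i = sum λ k → v k * B k i

  ·-linear : ∀ (B : Fin m → Vector ℤ n) → LinearMap (_· B)
  ·-linear B i .resp u≗v = sum-cong-≗ λ k → cong (_* B k i) (u≗v k)
  ·-linear B i .comb u c v = begin
    sum (λ k → (u k + c * v k) * B k i)
      ≡⟨ sum-cong-≗ (λ k → lem (u k) c (v k) (B k i)) ⟩
    sum (λ k → u k * B k i + c * (v k * B k i))
      ≡⟨ ∑-distrib-+ (λ k → u k * B k i) (λ k → c * (v k * B k i)) ⟩
    (u · B) i + sum (λ k → c * (v k * B k i))
      ≡⟨ cong (_+_ ((u · B) i)) (*-distribˡ-sum c (λ k → v k * B k i)) ⟨
    (u · B) i + c * (v · B) i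
      ∎
    where
    open ≡-Reasoning
    lem : ∀ u c v b → (u + c * v) * b ≡ u * b + c * (v * b)
    lem = solve-∀

  -- Alternating forms on a list of rows

  Repeat : ∀ m → (Vec (Vector ℤ n) m → ℤ) → Set
  Repeat (ℕ.suc (ℕ.suc m)) f = ∀ v A → f (v ∷ v ∷ A) ≡ 0ℤ
  Repeat _                 f = ⊤

  -- Only the first two rows are tested for equality. Fixing the head passes the condition on to the
  -- tail, which covers all adjacent pairs, and `swap` reaches the others. This shape lets every
  -- later proof recurse on the rows.
  data Alternating {n} : ∀ m → (Vec (Vector ℤ n) m → ℤ) → Set where
    []  : ∀ {f} → Alternating 0 f
    alt : ∀ {m f} →
          (∀ A → Linear λ v → f (v ∷ A)) →
          (∀ v → Alternating m λ A → f (v ∷ A)) →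
          Repeat (ℕ.suc m) f →
          Alternating (ℕ.suc m) f

  module _ {f : Vec (Vector ℤ n) (ℕ.suc m) → ℤ} where
    head-linear : Alternating (ℕ.suc m) f → ∀ A → Linear λ v → f (v ∷ A)
    head-linear (alt l _ _) = l

    tail-alternating : Alternating (ℕ.suc m) f → ∀ v → Alternating m λ A → f (v ∷ A)
    tail-alternating (alt _ t _) = t

  repeat : {f : Vec (Vector ℤ n) (ℕ.suc (ℕ.suc m)) → ℤ} →
           Alternating (ℕ.suc (ℕ.suc m)) f → ∀ v A → f (v ∷ v ∷ A) ≡ 0ℤ
  repeat (alt _ _ r) = r

  Alternating-resp-≗ : {f g : Vec (Vector ℤ n) m → ℤ} → f ≗ g → Alternating m f → Alternating m g
  Alternating-resp-≗ f≗g [] = []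
  Alternating-resp-≗ {n = n} {f = f} {g} f≗g (alt l t r) = alt
    (λ A → record
      { resp = λ u≗v → trans (sym (f≗g _)) (trans (l A .resp u≗v) (f≗g _))
      ; comb = λ u c v → trans (sym (f≗g _)) (trans (l A .comb u c v)
                           (cong₂ (λ x y → x + c * y) (f≗g _) (f≗g _)))
      })
    (λ v → Alternating-resp-≗ (λ A → f≗g (v ∷ A)) (t v))
    (repeat′ f≗g r)
    where
    repeat′ : ∀ {m} {f g : Vec (Vector ℤ n) m → ℤ} → f ≗ g → Repeat m f → Repeat m g
    repeat′ {m = 0}                 _   _ = _
    repeat′ {m = 1}                 _   _ = _
    repeat′ {m = ℕ.suc (ℕ.suc m)} f≗g r = λ v A → trans (sym (f≗g _)) (r v A)

  Alternating-∘map : {f : Vec (Vector ℤ n′) m → ℤ} {L : Vector ℤ n → Vector ℤ n′} →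
                     LinearMap L → Alternating m f → Alternating m (f ∘ map L)
  Alternating-∘map L [] = []
  Alternating-∘map {L = Λ} L (alt {m} {f} l t r) = alt
    (λ A → Linear-∘ (l (map Λ A)) L)
    (λ v → Alternating-∘map L (t (Λ v)))
    (repeat′ r)
    where
    repeat′ : ∀ {m} {f : Vec (Vector ℤ _) m → ℤ} → Repeat m f → Repeat m (f ∘ map Λ)
    repeat′ {m = 0}               _ = _
    repeat′ {m = 1}               _ = _
    repeat′ {m = ℕ.suc (ℕ.suc m)} r = λ v A → r (Λ v) (map Λ A)

  Alternating-sum : ∀ {k} {F : Fin k → Vec (Vector ℤ n) m → ℤ} (c : Fin k → ℤ) →
                    (∀ j → Alternating m (F j)) → Alternating m λ A → sum λ j → c j * F j A
  Alternating-sum {m = ℕ.zero}  c F = []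
  Alternating-sum {n = n} {m = ℕ.suc m} {F = Φ} c F = alt
    (λ A → Linear-sum c (λ j → head-linear (F j) A))
    (λ v → Alternating-sum c (λ j → tail-alternating (F j) v))
    (repeat′ F)
    where
    repeat′ : ∀ {m} {F : Fin _ → Vec (Vector ℤ n) m → ℤ} →
              (∀ j → Alternating m (F j)) → Repeat m λ A → sum λ j → c j * F j A
    repeat′ {m = 0}               _ = _
    repeat′ {m = 1}               _ = _
    repeat′ {m = ℕ.suc (ℕ.suc m)} F = λ v A →
      sum-zero λ j → trans (cong (c j *_) (repeat (F j) v A)) (ℤ.*-zeroʳ (c j))

  Alternating-cong : {f : Vec (Vector ℤ n) m → ℤ} → Alternating m f →
                     ∀ {A B} → Pointwise _≗_ A B → f A ≡ f B
  Alternating-cong []          []        = refl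
  Alternating-cong (alt l t _) (u≗v ∷ A≗B) =
    trans (l _ .resp u≗v) (Alternating-cong (t _) A≗B)

  module _ {f : Vec (Vector ℤ n) (ℕ.suc (ℕ.suc m)) → ℤ} (F : Alternating (ℕ.suc (ℕ.suc m)) f) where
    private
      second : ∀ u A → Linear λ v → f (u ∷ v ∷ A)
      second u = head-linear (tail-alternating F u)

    -- Polarisation: the form vanishes at (u + v, u + v), and so do two of the four terms of its
    -- expansion. The coefficients `1ℤ` only serve to fit `comb`.
    swap : ∀ u v A → f (u ∷ v ∷ A) ≡ - f (v ∷ u ∷ A)
    swap u v A = begin
      f (u ∷ v ∷ A)
        ≡⟨ lem _ _ _ _ (repeat F u A) (repeat F v A) ⟩
      f (u ∷ u ∷ A) + 1ℤ * f (u ∷ v ∷ A) + 1ℤ * (f (v ∷ u ∷ A) + 1ℤ * f (v ∷ v ∷ A)) - f (v ∷ u ∷ A)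
        ≡⟨ cong (_- f (v ∷ u ∷ A)) (cong₂ (λ x y → x + 1ℤ * y) (second u A .comb u 1ℤ v) (second v A .comb u 1ℤ v)) ⟨
      f (u ∷ w ∷ A) + 1ℤ * f (v ∷ w ∷ A) - f (v ∷ u ∷ A)
        ≡⟨ cong (_- f (v ∷ u ∷ A)) (head-linear F (w ∷ A) .comb u 1ℤ v) ⟨
      f (w ∷ w ∷ A) - f (v ∷ u ∷ A)
        ≡⟨ cong (_- f (v ∷ u ∷ A)) (repeat F w A) ⟩
      0ℤ - f (v ∷ u ∷ A)
        ≡⟨ ℤ.+-identityˡ _ ⟩
      - f (v ∷ u ∷ A)
        ∎
      where
      open ≡-Reasoning
      w : Vector ℤ n
      w i = u i + 1ℤ * v i
      lem′ : ∀ b c → b ≡ 0ℤ + 1ℤ * b + 1ℤ * (c + 1ℤ * 0ℤ) - c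
      lem′ = solve-∀
      lem : ∀ a b c d → a ≡ 0ℤ → d ≡ 0ℤ → b ≡ a + 1ℤ * b + 1ℤ * (c + 1ℤ * d) - c
      lem _ b c _ refl refl = lem′ b c

  repeat-at : ∀ {f : Vec (Vector ℤ n) (ℕ.suc m) → ℤ} → Alternating (ℕ.suc m) f →
              ∀ A i → f (lookup A i ∷ A) ≡ 0ℤ
  repeat-at F (v ∷ A) zero    = repeat F v A
  repeat-at F (v ∷ A) (suc i) =
    trans (swap F _ v A) (cong -_ (repeat-at (tail-alternating F v) A i))

  -- Row operations with pivot v. Swapping v past the row r makes v the head again, so that the
  -- recursion treats the rows below r.
  shear : ∀ {f : Vec (Vector ℤ n) (ℕ.suc m) → ℤ} → Alternating (ℕ.suc m) f →
          ∀ v {φ : Vector ℤ n → Vector ℤ n} {c : Vector ℤ n → ℤ} →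
          (∀ r i → φ r i ≡ r i + c r * v i) →
          ∀ A → f (v ∷ map φ A) ≡ f (v ∷ A)
  shear F v φ≗ [] = refl
  shear {f = f} F v {φ} {c} φ≗ (r ∷ A) = begin
    f (v ∷ φ r ∷ map φ A)
      ≡⟨ head-linear (tail-alternating F v) (map φ A) .resp (φ≗ r) ⟩
    f (v ∷ (λ i → r i + c r * v i) ∷ map φ A)
      ≡⟨ head-linear (tail-alternating F v) (map φ A) .comb r (c r) v ⟩
    f (v ∷ r ∷ map φ A) + c r * f (v ∷ v ∷ map φ A)
      ≡⟨ cong₂ (λ x y → x + c r * y) (swap F v r (map φ A)) (repeat F v (map φ A)) ⟩
    - f (r ∷ v ∷ map φ A) + c r * 0ℤ
      ≡⟨ cong (λ x → - x + c r * 0ℤ) (shear (tail-alternating F r) v {c = c} φ≗ A) ⟩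
    - f (r ∷ v ∷ A) + c r * 0ℤ
      ≡⟨ cong₂ _+_ (swap F v r A) (sym (ℤ.*-zeroʳ (c r))) ⟨
    f (v ∷ r ∷ A) + 0ℤ
      ≡⟨ ℤ.+-identityʳ _ ⟩
    f (v ∷ r ∷ A)
      ∎
    where open ≡-Reasoning

  -- Row j passes j other rows at one sign each. In `det-unique` this becomes the cofactor sign.
  move-to-front : ∀ {f : Vec (Vector ℤ n) (ℕ.suc m) → ℤ} → Alternating (ℕ.suc m) f →
                  ∀ (w : Fin (ℕ.suc m) → Vector ℤ n) j →
                  f (w j ∷ tabulate (w ∘ punchIn j)) ≡ -1ℤ ^ toℕ j * f (tabulate w)
  move-to-front F w zero = sym (ℤ.*-identityˡ _)
  move-to-front {m = ℕ.suc m} {f} F w (suc j) = begin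
    f (w (suc j) ∷ w zero ∷ tabulate (w ∘ suc ∘ punchIn j))
      ≡⟨ swap F _ _ _ ⟩
    - f (w zero ∷ w (suc j) ∷ tabulate (w ∘ suc ∘ punchIn j))
      ≡⟨ cong -_ (move-to-front (tail-alternating F (w zero)) (w ∘ suc) j) ⟩
    - (-1ℤ ^ toℕ j * f (tabulate w))
      ≡⟨ lem (-1ℤ ^ toℕ j) _ ⟩
    -1ℤ * -1ℤ ^ toℕ j * f (tabulate w)
      ∎
    where
    open ≡-Reasoning
    lem : ∀ s x → - (s * x) ≡ -1ℤ * s * x
    lem = solve-∀

  -- The cofactor determinant as the universal alternating form

  det-cong : ∀ {A B : Matrix n} → (∀ i j → A i j ≡ B i j) → det A ≡ det B
  det-cong {n = ℕ.zero}  A≡B = refl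
  det-cong {n = ℕ.suc n} A≡B = sum-cong-≗ λ j →
    cong₂ (λ x y → -1ℤ ^ toℕ j * x * y) (A≡B zero j) (det-cong λ i k → A≡B (suc i) (punchIn j k))

  delete : Fin (ℕ.suc n) → Vector ℤ (ℕ.suc n) → Vector ℤ n
  delete j v = v ∘ punchIn j

  delete-linear : ∀ (j : Fin (ℕ.suc n)) → LinearMap (delete j)
  delete-linear j i = Linear-coordinate (punchIn j i)

  det-rows : Vec (Vector ℤ n) n → ℤ
  det-rows A = det (lookup A)

  det-rows-∷ : ∀ v (A : Vec (Vector ℤ (ℕ.suc n)) n) →
               det-rows (v ∷ A) ≡ sum λ j → -1ℤ ^ toℕ j * v j * det-rows (map (delete j) A)
  det-rows-∷ v A = sum-cong-≗ λ j → cong (-1ℤ ^ toℕ j * v j *_)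
    (det-cong λ i k → sym (cong (λ r → r k) (lookup-map i (delete j) A)))

  -- Expanding a determinant along two equal rows v, v, the terms with columns
  -- (j , l) and (l , j) cancel.  Φ stands for the minor as a function of the
  -- embedding of the remaining columns.
  double-expansion : ∀ (v : Vector ℤ (ℕ.suc (ℕ.suc n))) (Φ : (Fin n → Fin (ℕ.suc (ℕ.suc n))) → ℤ) →
    (∀ {σ τ} → σ ≗ τ → Φ σ ≡ Φ τ) →
    (sum λ j → -1ℤ ^ toℕ j * v j * sum λ k →
      -1ℤ ^ toℕ k * v (punchIn j k) * Φ (punchIn j ∘ punchIn k)) ≡ 0ℤ
  double-expansion {n = n} v Φ Φ-cong = begin
    1ℤ * v zero * sum (λ k → -1ℤ ^ toℕ k * v (suc k) * ψ k) +
    sum (λ j → -1ℤ * -1ℤ ^ toℕ j * v (suc j) * (1ℤ * v zero * ψ j + inner j))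
      ≡⟨ cong₂ _+_ (*-distribˡ-sum (1ℤ * v zero) (λ k → -1ℤ ^ toℕ k * v (suc k) * ψ k))
           (trans (sum-cong-≗ λ j → split (-1ℤ ^ toℕ j) (v (suc j)) (v zero) (ψ j) (inner j))
                  (∑-distrib-+ (λ j → - first j) (λ j → -1ℤ * -1ℤ ^ toℕ j * v (suc j) * inner j))) ⟩
    sum first + (sum (λ j → - first j) + sum (λ j → -1ℤ * -1ℤ ^ toℕ j * v (suc j) * inner j))
      ≡⟨ ℤ.+-assoc (sum first) _ _ ⟨
    sum first + sum (λ j → - first j) + sum (λ j → -1ℤ * -1ℤ ^ toℕ j * v (suc j) * inner j)
      ≡⟨ cong₂ _+_ (trans (sym (∑-distrib-+ first (λ j → - first j)))
                          (sum-zero λ j → ℤ.+-inverseʳ (first j)))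
                   (inner-vanishes v Φ Φ-cong) ⟩
    0ℤ + 0ℤ
      ∎
    where
    open ≡-Reasoning
    ψ : Fin (ℕ.suc n) → ℤ
    ψ k = Φ (suc ∘ punchIn k)
    first : Fin (ℕ.suc n) → ℤ
    first k = 1ℤ * v zero * (-1ℤ ^ toℕ k * v (suc k) * ψ k)
    inner : Fin (ℕ.suc n) → ℤ
    inner j = sum λ k → -1ℤ * -1ℤ ^ toℕ k * v (suc (punchIn j k)) * Φ (punchIn (suc j) ∘ punchIn (suc k))
    split : ∀ s x y z t → -1ℤ * s * x * (1ℤ * y * z + t) ≡ - (1ℤ * y * (s * x * z)) + -1ℤ * s * x * t
    split = solve-∀
    -- Once the column pairs that contain column zero have cancelled, both chosen columns are
    -- successors. The two extra factors -1 cancel as well, and the sum is a double expansion of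
    -- `v ∘ suc`, with `lift` putting column zero back into the minor.
    inner-vanishes : ∀ {n} (v : Vector ℤ (ℕ.suc (ℕ.suc n))) (Φ : (Fin n → Fin (ℕ.suc (ℕ.suc n))) → ℤ) →
      (∀ {σ τ} → σ ≗ τ → Φ σ ≡ Φ τ) →
      (sum λ j → -1ℤ * -1ℤ ^ toℕ j * v (suc j) * sum λ k →
        -1ℤ * -1ℤ ^ toℕ k * v (suc (punchIn j k)) * Φ (punchIn (suc j) ∘ punchIn (suc k))) ≡ 0ℤ
    inner-vanishes {n = ℕ.zero}  v Φ Φ-cong =
      sum-zero λ j → ℤ.*-zeroʳ (-1ℤ * -1ℤ ^ toℕ j * v (suc j))
    inner-vanishes {n = ℕ.suc n} v Φ Φ-cong = begin
      (sum λ j → -1ℤ * -1ℤ ^ toℕ j * v (suc j) * sum λ k → term j k)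
        ≡⟨ sum-cong-≗ (λ j → trans (cong (-1ℤ * -1ℤ ^ toℕ j * v (suc j) *_)
             (trans (sum-cong-≗ λ k → trans (lem (-1ℤ ^ toℕ k) (v (suc (punchIn j k))) _)
                       (cong (λ φ → -1ℤ * (-1ℤ ^ toℕ k * v (suc (punchIn j k)) * φ))
                         (Φ-cong (shift j k))))
                    (sym (*-distribˡ-sum -1ℤ (term′ j)))))
             (lem₂ (-1ℤ ^ toℕ j) (v (suc j)) (sum (term′ j)))) ⟩
      (sum λ j → -1ℤ ^ toℕ j * v (suc j) * sum (term′ j))
        ≡⟨ double-expansion (v ∘ suc) Φ′ (λ σ≗τ → Φ-cong λ { zero → refl ; (suc x) → cong suc (σ≗τ x) }) ⟩
      0ℤ
        ∎
      where
      term term′ : Fin (ℕ.suc (ℕ.suc n)) → Fin (ℕ.suc n) → ℤ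
      term j k = -1ℤ * -1ℤ ^ toℕ k * v (suc (punchIn j k)) * Φ (punchIn (suc j) ∘ punchIn (suc k))
      lift : ∀ {m n} → (Fin m → Fin n) → Fin (ℕ.suc m) → Fin (ℕ.suc n)
      lift σ zero    = zero
      lift σ (suc x) = suc (σ x)
      Φ′ : (Fin n → Fin (ℕ.suc (ℕ.suc n))) → ℤ
      Φ′ σ = Φ (lift σ)
      term′ j k = -1ℤ ^ toℕ k * v (suc (punchIn j k)) * Φ′ (punchIn j ∘ punchIn k)
      shift : ∀ (j : Fin (ℕ.suc (ℕ.suc n))) (k : Fin (ℕ.suc n)) →
              punchIn (suc j) ∘ punchIn (suc k) ≗ lift (punchIn j ∘ punchIn k)
      shift j k zero    = refl
      shift j k (suc x) = refl
      lem : ∀ s x y → -1ℤ * s * x * y ≡ -1ℤ * (s * x * y)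
      lem = solve-∀
      lem₂ : ∀ s x y → -1ℤ * s * x * (-1ℤ * y) ≡ s * x * y
      lem₂ = solve-∀

  -- For a fixed first row, det is a combination of smaller determinants of the rows with column j
  -- deleted. Deletion is linear, so induction covers the tail, and equal first two rows are the
  -- case of `double-expansion`.
  det-alternating : ∀ n → Alternating n (det-rows {n})
  det-alternating ℕ.zero    = []
  det-alternating (ℕ.suc n) = alt
    (λ A → record
      { resp = λ {u} {v} u≗v → det-cong {A = lookup (u ∷ A)} {B = lookup (v ∷ A)}
          λ { zero j → u≗v j ; (suc i) j → refl }
      ; comb = λ u c v → trans
          (sum-cong-≗ λ j → distr (-1ℤ ^ toℕ j) (u j) c (v j) (minor A j))
          (trans (∑-distrib-+ (term A u) (λ j → c * term A v j))
            (cong (_+_ (det-rows (u ∷ A))) (sym (*-distribˡ-sum c (term A v)))))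
      })
    (λ v → Alternating-resp-≗ (λ A → sym (det-rows-∷ v A))
      (Alternating-sum (λ j → -1ℤ ^ toℕ j * v j)
        λ j → Alternating-∘map (delete-linear j) (det-alternating n)))
    (rep n)
    where
    minor : Vec (Vector ℤ (ℕ.suc n)) n → Fin (ℕ.suc n) → ℤ
    minor A j = det λ i k → lookup A i (punchIn j k)
    term : Vec (Vector ℤ (ℕ.suc n)) n → Vector ℤ (ℕ.suc n) → Fin (ℕ.suc n) → ℤ
    term A v j = -1ℤ ^ toℕ j * v j * minor A j
    distr : ∀ s u c v d → s * (u + c * v) * d ≡ s * u * d + c * (s * v * d)
    distr = solve-∀
    rep : ∀ n → Repeat (ℕ.suc n) (det-rows {ℕ.suc n})
    rep ℕ.zero    = _
    rep (ℕ.suc n) = λ v A → double-expansion v (λ σ → det λ i k → lookup A i (σ k))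
      (λ σ≗τ → det-cong λ i k → cong (lookup A i) (σ≗τ k))

  map-tabulate-≗ : ∀ {L : Vector ℤ n → Vector ℤ n′} {w : Fin m → Vector ℤ n} {w′ : Fin m → Vector ℤ n′} →
                   (∀ k → L (w k) ≗ w′ k) → Pointwise _≗_ (map L (tabulate w)) (tabulate w′)
  map-tabulate-≗ {m = ℕ.zero}  eq = []
  map-tabulate-≗ {m = ℕ.suc m} eq = eq zero ∷ map-tabulate-≗ (λ k → eq (suc k))

  -- Elimination without division: the first row is expanded in the basis, and each `e j` then
  -- clears column j of the other rows by `shear`. What is left is an alternating form on vectors
  -- shorter by one, to which induction applies.
  det-unique : ∀ {f : Vec (Vector ℤ n) n → ℤ} → Alternating n f →
               ∀ A → f A ≡ f (tabulate e) * det-rows A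
  det-unique {f = f} F [] = sym (ℤ.*-identityʳ _)
  det-unique {n = ℕ.suc n} {f} F (v ∷ A) = begin
    f (v ∷ A)
      ≡⟨ on-basis (head-linear F A) v ⟩
    (sum λ j → v j * f (e j ∷ A))
      ≡⟨ sum-cong-≗ (λ j → cong (v j *_) (expand j)) ⟩
    (sum λ j → v j * ((-1ℤ ^ toℕ j * f (tabulate e)) * det-rows (map (delete j) A)))
      ≡⟨ sum-cong-≗ (λ j → lem (v j) (-1ℤ ^ toℕ j) (f (tabulate e)) (det-rows (map (delete j) A))) ⟩
    (sum λ j → f (tabulate e) * (-1ℤ ^ toℕ j * v j * det-rows (map (delete j) A)))
      ≡⟨ *-distribˡ-sum (f (tabulate e)) (λ j → -1ℤ ^ toℕ j * v j * det-rows (map (delete j) A)) ⟨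
    f (tabulate e) * (sum λ j → -1ℤ ^ toℕ j * v j * det-rows (map (delete j) A))
      ≡⟨ cong (f (tabulate e) *_) (det-rows-∷ v A) ⟨
    f (tabulate e) * det-rows (v ∷ A)
      ∎
    where
    open ≡-Reasoning
    lem : ∀ v s c d → v * (s * c * d) ≡ c * (s * v * d)
    lem = solve-∀
    insert : Fin (ℕ.suc n) → Vector ℤ n → Vector ℤ (ℕ.suc n)
    insert j v = v · (e ∘ punchIn j)
    -- Setting coordinate j to zero is subtracting `r j` times `e j`, which exhibits it as a shear
    -- along `e j`.
    insert-delete : ∀ j r i → insert j (delete j r) i ≡ r i + - r j * e j i
    insert-delete j r i = trans (sub (r j * e j i) _) (trans
      (cong (_- r j * e j i) (trans (sym (sum-remove {i = j} (λ k → r k * e k i))) (sum-e r i)))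
      (cong (λ x → r i + x) (ℤ.neg-distribˡ-* (r j) (e j i))))
      where
      sub : ∀ x y → y ≡ x + y - x
      sub = solve-∀
    map-insert-delete : ∀ j {m} (B : Vec (Vector ℤ (ℕ.suc n)) m) →
      map (insert j ∘ delete j) B ≡ map (insert j) (map (delete j) B)
    map-insert-delete j []      = refl
    map-insert-delete j (r ∷ B) = cong (_ ∷_) (map-insert-delete j B)
    expand : ∀ j → f (e j ∷ A) ≡ (-1ℤ ^ toℕ j * f (tabulate e)) * det-rows (map (delete j) A)
    expand j = begin
      f (e j ∷ A)
        ≡⟨ shear F (e j) {c = λ r → - r j} (insert-delete j) A ⟨
      f (e j ∷ map (insert j ∘ delete j) A)
        ≡⟨ cong (λ B → f (e j ∷ B)) (map-insert-delete j A) ⟩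
      f (e j ∷ map (insert j) (map (delete j) A))
        ≡⟨ det-unique (Alternating-∘map (·-linear (e ∘ punchIn j)) (tail-alternating F (e j))) (map (delete j) A) ⟩
      f (e j ∷ map (insert j) (tabulate e)) * det-rows (map (delete j) A)
        ≡⟨ cong (_* det-rows (map (delete j) A))
             (Alternating-cong (tail-alternating F (e j))
               (map-tabulate-≗ {L = insert j} λ k i → e-sum k (λ l → e (punchIn j l) i))) ⟩
      f (e j ∷ tabulate (e ∘ punchIn j)) * det-rows (map (delete j) A)
        ≡⟨ cong (_* det-rows (map (delete j) A)) (move-to-front F e j) ⟩
      (-1ℤ ^ toℕ j * f (tabulate e)) * det-rows (map (delete j) A)
        ∎

  -- As a function of the rows of A, the left side is alternating, and at the identity matrix it
  -- takes the value det B.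
  det-* : ∀ (A B : Matrix n) → det (λ i → A i · B) ≡ det A * det B
  det-* {n = n} A B = begin
    det (λ i → A i · B)
      ≡⟨ det-cong (λ i k → cong (λ r → r k)
           (trans (lookup-map i (_· B) (tabulate A)) (cong (_· B) (lookup∘tabulate A i)))) ⟨
    det-rows (map (_· B) (tabulate A))
      ≡⟨ det-unique (Alternating-∘map (·-linear B) (det-alternating n)) (tabulate A) ⟩
    det-rows (map (_· B) (tabulate e)) * det-rows (tabulate A)
      ≡⟨ cong₂ _*_
           (trans (Alternating-cong (det-alternating n)
                    (map-tabulate-≗ {L = _· B} {w′ = B} λ k i → e-sum k (λ l → B l i)))
                  (det-cong λ i k → cong (λ r → r k) (lookup∘tabulate B i)))
           (det-cong λ i k → cong (λ r → r k) (lookup∘tabulate A i)) ⟩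
    det B * det A
      ≡⟨ ℤ.*-comm (det B) (det A) ⟩
    det A * det B
      ∎
    where open ≡-Reasoning

-- With p in this form, `p ∸ 1` and `p ∸ 2` compute to `suc r` and `r`, so `D p a b` is a
-- `Matrix (suc r)` of r-th powers by definition.
module OddPrime (k : ℕ) (isPrime : Prime (suc (suc k ℕ.+ suc k))) where
  open Determinant using (_·_; det-rows; det-alternating; repeat-at; det-*)

  -- Arithmetic modulo p = 2 n + 1

  n p r : ℕ
  n = suc k
  p = suc (n ℕ.+ n)
  r = k ℕ.+ n

  infix 4 _≈_ _≈?_

  -- A record lets x and y be inferred from the type `x ≈ y`; the underlying divisibility hides them
  -- inside `x - y`.
  record _≈_ (x y : ℤ) : Set where
    constructor mod
    field
      unmod : x ≡ y [mod p ]

  open _≈_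

  ≡⇒≈ : ∀ {x y} → x ≡ y → x ≈ y
  ≡⇒≈ {x} refl = mod (divides 0ℤ (ℤ.+-inverseʳ x))

  ≈-refl : ∀ {x} → x ≈ x
  ≈-refl = ≡⇒≈ refl

  private
    mod-by : ∀ {x y z} → z ≡ x - y → + p ∣ z → x ≈ y
    mod-by refl d = mod d

  ≈-sym : ∀ {x y} → x ≈ y → y ≈ x
  ≈-sym {x} {y} (mod d) = mod-by (lem x y) (∣m⇒∣-m d)
    where
    lem : ∀ x y → - (x - y) ≡ y - x
    lem = solve-∀

  ≈-trans : ∀ {x y z} → x ≈ y → y ≈ z → x ≈ z
  ≈-trans {x} {y} {z} (mod d) (mod e) = mod-by (lem x y z) (∣m∣n⇒∣m+n d e)
    where
    lem : ∀ x y z → (x - y) + (y - z) ≡ x - z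
    lem = solve-∀

  +-cong : ∀ {x y u v} → x ≈ y → u ≈ v → x + u ≈ y + v
  +-cong {x} {y} {u} {v} (mod d) (mod e) = mod-by (lem x y u v) (∣m∣n⇒∣m+n d e)
    where
    lem : ∀ x y u v → (x - y) + (u - v) ≡ x + u - (y + v)
    lem = solve-∀

  *-cong : ∀ {x y u v} → x ≈ y → u ≈ v → x * u ≈ y * v
  *-cong {x} {y} {u} {v} (mod d) (mod e) =
    mod-by (lem x y u v) (∣m∣n⇒∣m+n (∣m⇒∣m*n u d) (∣n⇒∣m*n y e))
    where
    lem : ∀ x y u v → (x - y) * u + y * (u - v) ≡ x * u - y * v
    lem = solve-∀

  -‿cong : ∀ {x y} → x ≈ y → - x ≈ - y
  -‿cong {x} {y} (mod d) = mod-by (lem x y) (∣m⇒∣-m d)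
    where
    lem : ∀ x y → - (x - y) ≡ - x - - y
    lem = solve-∀

  commutativeRing : CommutativeRing _ _
  commutativeRing = record
    { isCommutativeRing = record
      { isRing = record
        { +-isAbelianGroup = record
          { isGroup = record
            { isMonoid = record
              { isSemigroup = record
                { isMagma = record
                  { isEquivalence = record { refl = ≈-refl ; sym = ≈-sym ; trans = ≈-trans }
                  ; ∙-cong = +-cong
                  }
                ; assoc = λ x y z → ≡⇒≈ (ℤ.+-assoc x y z)
                }
              ; identity = (λ x → ≡⇒≈ (ℤ.+-identityˡ x)) , (λ x → ≡⇒≈ (ℤ.+-identityʳ x))
              }
            ; inverse = (λ x → ≡⇒≈ (ℤ.+-inverseˡ x)) , (λ x → ≡⇒≈ (ℤ.+-inverseʳ x))
            ; ⁻¹-cong = -‿cong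
            }
          ; comm = λ x y → ≡⇒≈ (ℤ.+-comm x y)
          }
        ; *-cong = *-cong
        ; *-assoc = λ x y z → ≡⇒≈ (ℤ.*-assoc x y z)
        ; *-identity = (λ x → ≡⇒≈ (ℤ.*-identityˡ x)) , (λ x → ≡⇒≈ (ℤ.*-identityʳ x))
        ; distrib = (λ x y z → ≡⇒≈ (ℤ.*-distribˡ-+ x y z)) , (λ x y z → ≡⇒≈ (ℤ.*-distribʳ-+ x y z))
        }
      ; *-comm = λ x y → ≡⇒≈ (ℤ.*-comm x y)
      }
    }

  private module 𝔽 = CommutativeRing commutativeRing

  open import Algebra.Properties.Semiring.Sum 𝔽.semiring public
    using (sum; sum-cong-≋; sum-replicate-zero; sum-remove; sum-permute; ∑-comm;
            ∑-distrib-+; *-distribˡ-sum)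
  open import Algebra.Properties.CommutativeMonoid.Sum 𝔽.*-commutativeMonoid public
    using () renaming
    ( sum to prod; sum-cong-≋ to prod-cong; sum-permute to prod-permute
    ; ∑-distrib-+ to prod-distrib-*)

  module ≈-Reasoning where
    open import Relation.Binary.Reasoning.Setoid 𝔽.setoid public

  +ˡ : ∀ x {y z} → y ≈ z → x + y ≈ x + z
  +ˡ x = +-cong (≈-refl {x})

  +ʳ : ∀ x {y z} → y ≈ z → y + x ≈ z + x
  +ʳ x y≈z = +-cong y≈z (≈-refl {x})

  *ˡ : ∀ x {y z} → y ≈ z → x * y ≈ x * z
  *ˡ x = *-cong (≈-refl {x})

  *ʳ : ∀ x {y z} → y ≈ z → y * x ≈ z * x
  *ʳ x y≈z = *-cong y≈z (≈-refl {x})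

  ^-cong : ∀ m {x y} → x ≈ y → x ^ m ≈ y ^ m
  ^-cong ℕ.zero  x≈y = ≈-refl
  ^-cong (suc m) {x} {y} x≈y = *-cong {x} {y} {x ^ m} {y ^ m} x≈y (^-cong m x≈y)

  ^-distribʳ-* : ∀ x y m → (x * y) ^ m ≡ x ^ m * y ^ m
  ^-distribʳ-* x y ℕ.zero  = refl
  ^-distribʳ-* x y (suc m) = trans (cong (x * y *_) (^-distribʳ-* x y m)) (lem x y (x ^ m) (y ^ m))
    where
    lem : ∀ a b c d → a * b * (c * d) ≡ a * c * (b * d)
    lem = solve-∀

  ≈0⇒∣ : ∀ {x} → x ≈ 0ℤ → + p ∣ x
  ≈0⇒∣ {x} (mod d) = subst (+ p ∣_) (ℤ.+-identityʳ x) d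

  ∣⇒≈0 : ∀ {x} → + p ∣ x → x ≈ 0ℤ
  ∣⇒≈0 {x} d = mod (subst (+ p ∣_) (sym (ℤ.+-identityʳ x)) d)

  abstract
    _≈?_ : ∀ x y → Dec (x ≈ y)
    x ≈? y = map′ mod unmod (+ p ∣? x - y)

  -≈0 : ∀ {x y} → x - y ≈ 0ℤ → x ≈ y
  -≈0 d = mod (≈0⇒∣ d)

  ≈⇒-≈0 : ∀ {x y} → x ≈ y → x - y ≈ 0ℤ
  ≈⇒-≈0 (mod d) = ∣⇒≈0 d

  *≈0 : ∀ x y → x * y ≈ 0ℤ → x ≈ 0ℤ ⊎ y ≈ 0ℤ
  *≈0 x y xy≈0 =
    [ inj₁ ∘ ∣⇒≈0 ∘ ∣ᵤ⇒∣ , inj₂ ∘ ∣⇒≈0 ∘ ∣ᵤ⇒∣ ]′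
      (euclidsLemma ∣ x ∣ ∣ y ∣ isPrime (subst (p ∣ₙ_) (ℤ.abs-* x y) (∣⇒∣ᵤ (≈0⇒∣ xy≈0))))

  *-nonzero : ∀ {x y} → ¬ x ≈ 0ℤ → ¬ y ≈ 0ℤ → ¬ x * y ≈ 0ℤ
  *-nonzero {x} {y} x≉0 y≉0 = [ x≉0 , y≉0 ]′ ∘ *≈0 x y

  *-cancelˡ : ∀ x {y z} → ¬ x ≈ 0ℤ → x * y ≈ x * z → y ≈ z
  *-cancelˡ x {y} {z} x≉0 eq =
    [ ⊥-elim ∘ x≉0 , -≈0 ]′ (*≈0 x (y - z) (≈-trans (≡⇒≈ (lem x y z)) (≈⇒-≈0 eq)))
    where
    lem : ∀ x y z → x * (y - z) ≡ x * y - x * z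
    lem = solve-∀

  small-nonzero : ∀ m → suc m ℕ.< p → ¬ + suc m ≈ 0ℤ
  small-nonzero m m<p eq = >⇒∤ m<p (∣⇒∣ᵤ (≈0⇒∣ eq))

  1≉0 : ¬ 1ℤ ≈ 0ℤ
  1≉0 = small-nonzero 0 (ℕ.s≤s (ℕ.s≤s ℕ.z≤n))

  2≉0 : ¬ + 2 ≈ 0ℤ
  2≉0 = small-nonzero 1 (ℕ.s≤s (ℕ.s≤s (ℕ.m≤n⇒m≤o+n k (ℕ.s≤s ℕ.z≤n))))

  ^-nonzero : ∀ m {x} → ¬ x ≈ 0ℤ → ¬ x ^ m ≈ 0ℤ
  ^-nonzero ℕ.zero  x≉0 = 1≉0
  ^-nonzero (suc m) x≉0 = *-nonzero x≉0 (^-nonzero m x≉0)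

  prod-nonzero : ∀ {m} (f : Fin m → ℤ) → (∀ i → ¬ f i ≈ 0ℤ) → ¬ prod f ≈ 0ℤ
  prod-nonzero {ℕ.zero} f f≉0 = 1≉0
  prod-nonzero {suc m}  f f≉0 = *-nonzero (f≉0 zero) (prod-nonzero (f ∘ suc) (f≉0 ∘ suc))

  prod-scale : ∀ {m} c (f : Fin m → ℤ) → prod (λ i → c * f i) ≡ c ^ m * prod f
  prod-scale {ℕ.zero} c f = refl
  prod-scale {suc m}  c f =
    trans (cong (c * f zero *_) (prod-scale c (f ∘ suc))) (lem c (f zero) (c ^ m) (prod (f ∘ suc)))
    where
    lem : ∀ a b c d → a * b * (c * d) ≡ a * c * (b * d)
    lem = solve-∀

  sum-zero-≈ : ∀ {m} (f : Fin m → ℤ) → (∀ i → f i ≈ 0ℤ) → sum f ≈ 0ℤ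
  sum-zero-≈ {m} f f≈0 = ≈-trans (sum-cong-≋ f≈0) (sum-replicate-zero m)

  -- Residues modulo p and sums over them

  rep : Fin p → ℤ
  rep i = + toℕ i

  rep-injective : ∀ {i j} → rep i ≈ rep j → i ≡ j
  rep-injective {i} {j} eq = toℕ-injective (ℤ.+-injective (ℤ.i-j≡0⇒i≡j (rep i) (rep j)
    (ℤ.∣i∣≡0⇒i≡0 (small ∣ rep i - rep j ∣ bound (∣⇒∣ᵤ (unmod eq))))))
    where
    small : ∀ m → m ℕ.< p → p ∣ₙ m → m ≡ 0
    small ℕ.zero  _   _ = refl
    small (suc m) m<p d = ⊥-elim (>⇒∤ m<p d)
    bound : ∣ rep i - rep j ∣ ℕ.< p
    bound = subst (ℕ._< p) (sym (cong ∣_∣ (ℤ.m-n≡m⊖n (toℕ i) (toℕ j))))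
      (ℕ.≤-<-trans (ℤ.∣m⊝n∣≤m⊔n (toℕ i) (toℕ j)) (ℕ.⊔-lub (toℕ<n i) (toℕ<n j)))

  abstract
    residue : ℤ → Fin p
    residue x = fromℕ< (n%ℕd<d x p)

    rep-residue : ∀ x → rep (residue x) ≈ x
    rep-residue x = ≈-sym (mod (divides (x /ℕ p) (trans
      (cong (λ z → x - z) (cong +_ (toℕ-fromℕ< (n%ℕd<d x p))))
      (trans (cong (_- + (x %ℕ p)) (a≡a%ℕn+[a/ℕn]*n x p)) (lem (+ (x %ℕ p)) (x /ℕ p * + p))))))
      where
      lem : ∀ a b → a + b - a ≡ b
      lem = solve-∀

  rep-suc≉0 : ∀ (i : Fin (n ℕ.+ n)) → ¬ rep (suc i) ≈ 0ℤ
  rep-suc≉0 i = small-nonzero (toℕ i) (ℕ.s≤s (toℕ<n i))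

  Respectful : (ℤ → ℤ) → Set
  Respectful F = ∀ {x y} → x ≈ y → F x ≈ F y

  ∑ : (ℤ → ℤ) → ℤ
  ∑ F = sum (F ∘ rep)

  ∑-cong : ∀ {F G} → (∀ x → F x ≈ G x) → ∑ F ≈ ∑ G
  ∑-cong F≈G = sum-cong-≋ (F≈G ∘ rep)

  -- Substitutions are given as maps on integers; this turns them into the permutations of `Fin p`
  -- that reindex sums and products.
  residue-permutation : ∀ {f g : ℤ → ℤ} → Respectful f → Respectful g →
    (∀ x → f (g x) ≈ x) → (∀ x → g (f x) ≈ x) →
    ∃ λ (π : Permutation p p) → ∀ i → rep (π ⟨$⟩ʳ i) ≈ f (rep i)
  residue-permutation {f} {g} f-resp g-resp fg gf =
    permutation (residue ∘ f ∘ rep) (residue ∘ g ∘ rep) (inv f-resp fg) (inv g-resp gf) ,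
    λ i → rep-residue (f (rep i))
    where
    inv : ∀ {f g : ℤ → ℤ} → Respectful f → (∀ x → f (g x) ≈ x) →
          ∀ i → residue (f (rep (residue (g (rep i))))) ≡ i
    inv {f} {g} f-resp fg i = rep-injective
      (≈-trans (rep-residue _) (≈-trans (f-resp (rep-residue (g (rep i)))) (fg (rep i))))

  ∑-reindex : ∀ {F f g} → Respectful F → Respectful f → Respectful g →
    (∀ x → f (g x) ≈ x) → (∀ x → g (f x) ≈ x) → ∑ F ≈ ∑ (F ∘ f)
  ∑-reindex {F} F-resp f-resp g-resp fg gf =
    let π , π≈f = residue-permutation f-resp g-resp fg gf
    in ≈-trans (sum-permute (F ∘ rep) π) (sum-cong-≋ λ i → F-resp (π≈f i))

  ∑-comm′ : ∀ (F : ℤ → ℤ → ℤ) → ∑ (λ x → ∑ (F x)) ≈ ∑ (λ y → ∑ (λ x → F x y))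
  ∑-comm′ F = ∑-comm λ i j → F (rep i) (rep j)

  ∑-select : ∀ {F} → Respectful F → ∀ c → (∀ x → ¬ x ≈ c → F x ≈ 0ℤ) → ∑ F ≈ F c
  ∑-select {F} F-resp c F≈0 = begin
    ∑ F
      ≈⟨ sum-remove {i = residue c} (F ∘ rep) ⟩
    F (rep (residue c)) + sum (F ∘ rep ∘ punchIn (residue c))
      ≈⟨ +-cong (F-resp (rep-residue c)) (sum-zero-≈ (F ∘ rep ∘ punchIn (residue c))
           λ i → F≈0 _ λ eq → punchInᵢ≢i (residue c) i (rep-injective (≈-trans eq (≈-sym (rep-residue c))))) ⟩
    F c + 0ℤ
      ≡⟨ ℤ.+-identityʳ (F c) ⟩
    F c
      ∎
    where open ≈-Reasoning

  abstract
    -- Pigeonhole: if no multiple of v were 1, then i ↦ v i would inject the p residues into the p -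
    -- 1 residues other than 1.
    inverse-exists : ∀ {v} → ¬ v ≈ 0ℤ → ∃ λ w → v * w ≈ 1ℤ
    inverse-exists {v} v≉0 with any? (λ i → (v * rep i) ≈? 1ℤ)
    ... | yes (i , vi≈1) = rep i , vi≈1
    ... | no none = ⊥-elim (<⇒notInjective {f = f} (ℕ.n<1+n (n ℕ.+ n)) f-injective)
      where
      avoids : ∀ i → ¬ residue 1ℤ ≡ residue (v * rep i)
      avoids i eq = none (i , ≈-trans (≈-sym (rep-residue (v * rep i)))
                                (≈-trans (≡⇒≈ (cong rep (sym eq))) (rep-residue 1ℤ)))
      f : Fin p → Fin (n ℕ.+ n)
      f i = punchOut (avoids i)
      f-injective : ∀ {i j} → f i ≡ f j → i ≡ j
      f-injective {i} {j} eq = rep-injective (*-cancelˡ v v≉0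
        (≈-trans (≈-sym (rep-residue (v * rep i)))
          (≈-trans (≡⇒≈ (cong rep (punchOut-injective (avoids i) (avoids j) eq))) (rep-residue (v * rep j)))))

  inverse-unique : ∀ x {y z} → x * y ≈ 1ℤ → x * z ≈ 1ℤ → y ≈ z
  inverse-unique x {y} {z} xy≈1 xz≈1 = *-cancelˡ x x≉0 (≈-trans xy≈1 (≈-sym xz≈1))
    where
    x≉0 : ¬ x ≈ 0ℤ
    x≉0 x≈0 = 1≉0 (≈-trans (≈-sym xy≈1) (*ʳ y x≈0))

  scaling-inverse : ∀ v w → v * w ≈ 1ℤ → ∀ x → v * (w * x) ≈ x
  scaling-inverse v w vw≈1 x =
    ≈-trans (≡⇒≈ (sym (ℤ.*-assoc v w x))) (≈-trans (*ʳ x vw≈1) (≡⇒≈ (ℤ.*-identityˡ x)))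

  ∑-scale : ∀ {F v} → Respectful F → ¬ v ≈ 0ℤ → ∑ F ≈ ∑ (λ x → F (v * x))
  ∑-scale {v = v} F-resp v≉0 =
    let w , vw≈1 = inverse-exists v≉0
    in ∑-reindex F-resp (*ˡ v) (*ˡ w) (scaling-inverse v w vw≈1)
         (scaling-inverse w v (≈-trans (≡⇒≈ (ℤ.*-comm w v)) vw≈1))

  ∑-shift : ∀ {F} v → Respectful F → ∑ F ≈ ∑ (λ x → F (x + v))
  ∑-shift v F-resp = ∑-reindex {g = λ x → x - v} F-resp (+ʳ v) (+ʳ (- v))
    (λ x → ≡⇒≈ (lem x v)) (λ x → ≡⇒≈ (lem′ x v))
    where
    lem : ∀ x v → x - v + v ≡ x
    lem = solve-∀
    lem′ : ∀ x v → x + v - v ≡ x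
    lem′ = solve-∀

  -- Multiplication by v permutes the nonzero residues, so their product P satisfies v^(p-1) P = P.
  fermat : ∀ {x} → ¬ x ≈ 0ℤ → x ^ (n ℕ.+ n) ≈ 1ℤ
  fermat {v} v≉0 = *-cancelˡ P (prod-nonzero _ rep-suc≉0) (begin
    P * v ^ (n ℕ.+ n)
      ≡⟨ ℤ.*-comm P _ ⟩
    v ^ (n ℕ.+ n) * P
      ≡⟨ prod-scale v (rep ∘ suc) ⟨
    prod (λ (i : Fin (n ℕ.+ n)) → v * rep (suc i))
      ≈⟨ prod-cong (λ i → w-nonzero (*-nonzero v≉0 (rep-suc≉0 i))) ⟨
    prod (λ (i : Fin (n ℕ.+ n)) → w (v * rep (suc i)))
      ≡⟨ ℤ.*-identityˡ _ ⟨
    1ℤ * prod (λ (i : Fin (n ℕ.+ n)) → w (v * rep (suc i)))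
      ≈⟨ *ʳ _ (w-zero (≡⇒≈ (ℤ.*-zeroʳ v))) ⟨
    prod (λ i → w (v * rep i))
      ≈⟨ prod-cong (λ i → w-resp (π≈v i)) ⟨
    prod (λ i → w (rep (π ⟨$⟩ʳ i)))
      ≈⟨ prod-permute (w ∘ rep) π ⟨
    prod (w ∘ rep)
      ≈⟨ *-cong (w-zero ≈-refl) (prod-cong λ i → w-nonzero (rep-suc≉0 i)) ⟩
    1ℤ * P
      ≡⟨ ℤ.*-comm 1ℤ P ⟩
    P * 1ℤ
      ∎)
    where
    open ≈-Reasoning
    v-inverse : ∃ λ u → v * u ≈ 1ℤ
    v-inverse = inverse-exists v≉0
    u : ℤ
    u = proj₁ v-inverse
    vu≈1 : v * u ≈ 1ℤ
    vu≈1 = proj₂ v-inverse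
    v-permutation : ∃ λ (π : Permutation p p) → ∀ i → rep (π ⟨$⟩ʳ i) ≈ v * rep i
    v-permutation = residue-permutation {v *_} {u *_} (*ˡ v) (*ˡ u) (scaling-inverse v u vu≈1)
                       (scaling-inverse u v (≈-trans (≡⇒≈ (ℤ.*-comm u v)) vu≈1))
    π : Permutation p p
    π = proj₁ v-permutation
    π≈v : ∀ i → rep (π ⟨$⟩ʳ i) ≈ v * rep i
    π≈v = proj₂ v-permutation
    P : ℤ
    P = prod λ (i : Fin (n ℕ.+ n)) → rep (suc i)
    -- Replacing the factor 0 by 1 makes the product over all p residues equal to P, so the
    -- permutation of the whole of `Fin p` can be used.
    w : ℤ → ℤ
    w x = if does (x ≈? 0ℤ) then 1ℤ else x
    w-zero : ∀ {x} → x ≈ 0ℤ → w x ≈ 1ℤ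
    w-zero {x} x≈0 = ≡⇒≈ (cong (if_then 1ℤ else x) (dec-true (x ≈? 0ℤ) x≈0))
    w-nonzero : ∀ {x} → ¬ x ≈ 0ℤ → w x ≈ x
    w-nonzero {x} x≉0 = ≡⇒≈ (cong (if_then 1ℤ else x) (dec-false (x ≈? 0ℤ) x≉0))
    w-resp : ∀ {x y} → x ≈ y → w x ≈ w y
    w-resp {x} {y} x≈y = w-resp′ (x ≈? 0ℤ)
      where
      w-resp′ : Dec (x ≈ 0ℤ) → w x ≈ w y
      w-resp′ (yes x≈0) = ≈-trans (w-zero x≈0) (≈-sym (w-zero (≈-trans (≈-sym x≈y) x≈0)))
      w-resp′ (no  x≉0) = ≈-trans (w-nonzero x≉0)
        (≈-trans x≈y (≈-sym (w-nonzero λ y≈0 → x≉0 (≈-trans x≈y y≈0))))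

  -- Being total with 0 ↦ 0, this is an involution on all residues and so a legitimate substitution
  -- in `∑`.
  inv : ℤ → ℤ
  inv x = x ^ r

  inverseʳ : ∀ {x} → ¬ x ≈ 0ℤ → x * inv x ≈ 1ℤ
  inverseʳ = fermat

  inv-resp : Respectful inv
  inv-resp = ^-cong r

  ^-zero : ∀ m {x} → x ≈ 0ℤ → x ^ suc m ≈ 0ℤ
  ^-zero m {x} x≈0 = *ʳ (x ^ m) x≈0

  r≡ : r ≡ suc (k ℕ.+ k)
  r≡ = ℕ.+-suc k k

  inv-zero : ∀ {x} → x ≈ 0ℤ → inv x ≈ 0ℤ
  inv-zero {x} x≈0 = ≈-trans (≡⇒≈ (cong (x ^_) r≡)) (^-zero (k ℕ.+ k) x≈0)

  inv-nonzero : ∀ {x} → ¬ x ≈ 0ℤ → ¬ inv x ≈ 0ℤ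
  inv-nonzero = ^-nonzero r

  inv-involutive : ∀ x → inv (inv x) ≈ x
  inv-involutive x with x ≈? 0ℤ
  ... | yes x≈0 = ≈-trans (inv-zero (inv-zero x≈0)) (≈-sym x≈0)
  ... | no  x≉0 = inverse-unique (inv x) (inverseʳ (inv-nonzero x≉0))
                    (≈-trans (≡⇒≈ (ℤ.*-comm (inv x) x)) (inverseʳ x≉0))

  ∑-inv : ∀ {F} → Respectful F → ∑ F ≈ ∑ (λ x → F (inv x))
  ∑-inv F-resp = ∑-reindex F-resp inv-resp inv-resp inv-involutive inv-involutive

  -- By Fermat, the indicator of 0 as a polynomial, which respects `≈` with no case distinction.
  δ : ℤ → ℤ
  δ x = 1ℤ - x ^ (n ℕ.+ n)

  δ-resp : Respectful δ
  δ-resp x≈y = +ˡ 1ℤ (-‿cong (^-cong (n ℕ.+ n) x≈y))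

  δ-zero : ∀ {x} → x ≈ 0ℤ → δ x ≈ 1ℤ
  δ-zero x≈0 = +ˡ 1ℤ (-‿cong (^-zero r x≈0))

  δ-nonzero : ∀ {x} → ¬ x ≈ 0ℤ → δ x ≈ 0ℤ
  δ-nonzero x≉0 = +ˡ 1ℤ (-‿cong (fermat x≉0))

  ∑-δ : ∀ {F} → Respectful F → ∀ c → ∑ (λ x → F x * δ (x - c)) ≈ F c
  ∑-δ {F} F-resp c = ≈-trans
    (∑-select (λ x≈y → *-cong (F-resp x≈y) (δ-resp (+ʳ (- c) x≈y))) c
      (λ x x≉c → ≈-trans (*ˡ (F x) (δ-nonzero (λ d → x≉c (-≈0 d)))) (≡⇒≈ (ℤ.*-zeroʳ (F x)))))
    (≈-trans (*ˡ (F c) (δ-zero (≡⇒≈ (ℤ.+-inverseʳ c)))) (≡⇒≈ (ℤ.*-identityʳ (F c))))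

  ∑-distrib-+′ : ∀ F G → ∑ (λ x → F x + G x) ≈ ∑ F + ∑ G
  ∑-distrib-+′ F G = ∑-distrib-+ (F ∘ rep) (G ∘ rep)

  ∑-*ˡ : ∀ c F → ∑ (λ x → c * F x) ≈ c * ∑ F
  ∑-*ˡ c F = ≈-sym (*-distribˡ-sum c (F ∘ rep))

  -- Subtracting `F b * δ (x - b)` from F removes the point b and leaves a case for `∑-select`.
  ∑-select₂ : ∀ {F} → Respectful F → ∀ a b → ¬ a ≈ b →
              (∀ x → ¬ x ≈ a → ¬ x ≈ b → F x ≈ 0ℤ) → ∑ F ≈ F a + F b
  ∑-select₂ {F} F-resp a b a≉b F≈0 = begin
    ∑ F
      ≡⟨ lem (∑ F) (F b) ⟩
    ∑ F + - F b * 1ℤ + F b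
      ≈⟨ +ʳ (F b) (+ˡ (∑ F) (≈-trans (*ˡ (- F b) (≈-sym one)) (≈-sym (∑-*ˡ (- F b) (λ x → δ (x - b)))))) ⟩
    ∑ F + ∑ (λ x → - F b * δ (x - b)) + F b
      ≈⟨ +ʳ (F b) (∑-distrib-+′ F (λ x → - F b * δ (x - b))) ⟨
    ∑ (λ x → F x + - F b * δ (x - b)) + F b
      ≈⟨ +ʳ (F b) (∑-select G-resp a G≈0) ⟩
    F a + - F b * δ (a - b) + F b
      ≈⟨ +ʳ (F b) (+ˡ (F a) (*ˡ (- F b) (δ-nonzero (a≉b ∘ -≈0)))) ⟩
    F a + - F b * 0ℤ + F b
      ≡⟨ lem′ (F a) (F b) ⟩
    F a + F b
      ∎
    where
    open ≈-Reasoning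
    lem : ∀ s x → s ≡ s + - x * 1ℤ + x
    lem = solve-∀
    lem′ : ∀ x y → x + - y * 0ℤ + y ≡ x + y
    lem′ = solve-∀
    lem″ : ∀ x → x + - x * 1ℤ ≡ 0ℤ
    lem″ = solve-∀
    one : ∑ (λ x → δ (x - b)) ≈ 1ℤ
    one = ≈-trans (∑-cong λ x → ≡⇒≈ (sym (ℤ.*-identityˡ (δ (x - b))))) (∑-δ (λ _ → ≈-refl) b)
    G-resp : Respectful λ x → F x + - F b * δ (x - b)
    G-resp x≈y = +-cong (F-resp x≈y) (*ˡ (- F b) (δ-resp (+ʳ (- b) x≈y)))
    G≈0 : ∀ x → ¬ x ≈ a → F x + - F b * δ (x - b) ≈ 0ℤ
    G≈0 x x≉a with x ≈? b
    ... | yes x≈b = ≈-trans (+-cong (F-resp x≈b) (*ˡ (- F b) (δ-zero (≈⇒-≈0 x≈b)))) (≡⇒≈ (lem″ (F b)))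
    ... | no  x≉b = ≈-trans (+-cong (F≈0 x x≉a x≉b) (*ˡ (- F b) (δ-nonzero (x≉b ∘ -≈0)))) (≡⇒≈ (cong (_+_ 0ℤ) (ℤ.*-zeroʳ (- F b))))

  -- Determinants modulo p

  det-cong-≈ : ∀ {m} {A B : Matrix m} → (∀ i j → A i j ≈ B i j) → det A ≈ det B
  det-cong-≈ {ℕ.zero} A≈B = ≈-refl
  det-cong-≈ {suc m}  A≈B = sum-cong-≋ λ j →
    *-cong (*ˡ (-1ℤ ^ toℕ j) (A≈B zero j)) (det-cong-≈ λ i l → A≈B (suc i) (punchIn j l))

  det-diagonal : ∀ {m} (A : Matrix m) → (∀ i j → ¬ i ≡ j → A i j ≈ 0ℤ) → det A ≈ prod λ i → A i i
  det-diagonal {ℕ.zero} A off = ≈-refl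
  det-diagonal {suc m}  A off = begin
    1ℤ * A zero zero * det (λ i j → A (suc i) (suc j)) + sum (λ j → rest j)
      ≈⟨ +-cong (*-cong (≡⇒≈ (ℤ.*-identityˡ (A zero zero)))
                  (det-diagonal (λ i j → A (suc i) (suc j)) λ i j i≢j → off (suc i) (suc j) (i≢j ∘ suc-injective)))
                (sum-zero-≈ rest λ j → ≈-trans
                  (*ʳ (minor j) (*ˡ (-1ℤ ^ toℕ (suc j)) (off zero (suc j) λ ())))
                  (≡⇒≈ (lem (-1ℤ ^ toℕ (suc j)) (minor j)))) ⟩
    A zero zero * prod (λ i → A (suc i) (suc i)) + 0ℤ
      ≡⟨ ℤ.+-identityʳ _ ⟩
    A zero zero * prod (λ i → A (suc i) (suc i))
      ∎
    where
    open ≈-Reasoning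
    minor rest : Fin m → ℤ
    minor j = det λ i l → A (suc i) (punchIn (suc j) l)
    rest j  = -1ℤ ^ toℕ (suc j) * A zero (suc j) * minor j
    lem : ∀ s d → s * 0ℤ * d ≡ 0ℤ
    lem = solve-∀

  det-scale-rows : ∀ {m} (c : Fin m → ℤ) (A : Matrix m) → det (λ i j → c i * A i j) ≈ prod c * det A
  det-scale-rows {ℕ.zero} c A = ≈-refl
  det-scale-rows {suc m}  c A = ≈-trans
    (sum-cong-≋ λ j → ≈-trans
      (*ˡ (-1ℤ ^ toℕ j * (c zero * A zero j)) (det-scale-rows (c ∘ suc) λ i l → A (suc i) (punchIn j l)))
      (≡⇒≈ (lem (-1ℤ ^ toℕ j) (c zero) (A zero j) (prod (c ∘ suc)) (minor j))))
    (≈-sym (*-distribˡ-sum (prod c) λ j → -1ℤ ^ toℕ j * A zero j * minor j))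
    where
    minor : Fin (suc m) → ℤ
    minor j = det λ i l → A (suc i) (punchIn j l)
    lem : ∀ s c a d e → s * (c * a) * (d * e) ≡ c * d * (s * a * e)
    lem = solve-∀

  -- The rows are only congruent. Replacing row zero by an exact copy of row `suc i` keeps det
  -- modulo p and makes `repeat-at` applicable.
  det-equal-rows : ∀ {m} (A : Matrix (suc m)) (i : Fin m) → (∀ j → A zero j ≈ A (suc i) j) → det A ≈ 0ℤ
  det-equal-rows {m} A i eq = begin
    det A
      ≈⟨ det-cong-≈ {A = A} {B = lookup rows} (λ
           { zero    j → ≈-trans (eq j) (lookup-rest i j)
           ; (suc l) j → lookup-rest l j
           }) ⟩
    det-rows rows
      ≡⟨ repeat-at (det-alternating (suc m)) (tabulate (A ∘ suc)) i ⟩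
    0ℤ
      ∎
    where
    open ≈-Reasoning
    rows : Vec (Vector ℤ (suc m)) (suc m)
    rows = lookup (tabulate (A ∘ suc)) i ∷ tabulate (A ∘ suc)
    lookup-rest : ∀ l j → A (suc l) j ≈ lookup (tabulate (A ∘ suc)) l j
    lookup-rest l j = ≡⇒≈ (cong (λ v → v j) (sym (lookup∘tabulate (A ∘ suc) l)))

  -- The polynomial (x^(N+1) - y^(N+1)) / (x - y). At N = r and nonzero x, y it vanishes by Fermat
  -- unless x ≈ y: the orthogonality of the power characters.
  homogeneous : ℕ → ℤ → ℤ → ℤ
  homogeneous N x y = sum λ (m : Fin (suc N)) → x ^ (N ℕ.∸ toℕ m) * y ^ toℕ m

  homogeneous-suc : ∀ N x y → homogeneous (suc N) x y ≈ x ^ suc N + y * homogeneous N x y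
  homogeneous-suc N x y = +-cong (≡⇒≈ (ℤ.*-identityʳ (x ^ suc N))) (≈-trans
    (sum-cong-≋ {suc N} λ m → ≡⇒≈ (lem (x ^ (N ℕ.∸ toℕ m)) y (y ^ toℕ m)))
    (≈-sym (*-distribˡ-sum y λ (m : Fin (suc N)) → x ^ (N ℕ.∸ toℕ m) * y ^ toℕ m)))
    where
    lem : ∀ a y b → a * (y * b) ≡ y * (a * b)
    lem = solve-∀

  homogeneous-telescope : ∀ N x y → (x - y) * homogeneous N x y ≈ x ^ suc N - y ^ suc N
  homogeneous-telescope ℕ.zero x y = ≡⇒≈ (lem x y)
    where
    lem : ∀ x y → (x - y) * (1ℤ * 1ℤ + 0ℤ) ≡ x * 1ℤ - y * 1ℤ
    lem = solve-∀
  homogeneous-telescope (suc N) x y = begin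
    (x - y) * homogeneous (suc N) x y
      ≈⟨ *ˡ (x - y) (homogeneous-suc N x y) ⟩
    (x - y) * (x ^ suc N + y * homogeneous N x y)
      ≡⟨ lem x y (x ^ suc N) (homogeneous N x y) ⟩
    (x - y) * x ^ suc N + y * ((x - y) * homogeneous N x y)
      ≈⟨ +ˡ ((x - y) * x ^ suc N) (*ˡ y (homogeneous-telescope N x y)) ⟩
    (x - y) * x ^ suc N + y * (x ^ suc N - y ^ suc N)
      ≡⟨ lem′ x y (x ^ suc N) (y ^ suc N) ⟩
    x * x ^ suc N - y * y ^ suc N
      ∎
    where
    open ≈-Reasoning
    lem : ∀ x y a g → (x - y) * (a + y * g) ≡ (x - y) * a + y * ((x - y) * g)
    lem = solve-∀
    lem′ : ∀ x y a b → (x - y) * a + y * (a - b) ≡ x * a - y * b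
    lem′ = solve-∀

  homogeneous-diagonal : ∀ N {x y} → x ≈ y → homogeneous N x y ≈ + suc N * x ^ N
  homogeneous-diagonal ℕ.zero      x≈y = ≈-refl
  homogeneous-diagonal (suc N) {x} {y} x≈y = begin
    homogeneous (suc N) x y
      ≈⟨ homogeneous-suc N x y ⟩
    x ^ suc N + y * homogeneous N x y
      ≈⟨ +ˡ (x ^ suc N) (*-cong (≈-sym x≈y) (homogeneous-diagonal N x≈y)) ⟩
    x * x ^ N + x * (+ suc N * x ^ N)
      ≡⟨ lem x (x ^ N) (+ suc N) ⟩
    (1ℤ + + suc N) * (x * x ^ N)
      ∎
    where
    open ≈-Reasoning
    lem : ∀ x a c → x * a + x * (c * a) ≡ (1ℤ + c) * (x * a)
    lem = solve-∀

  p≈0 : + p ≈ 0ℤ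
  p≈0 = ∣⇒≈0 ∣-refl

  p-1≈-1 : + suc r ≈ -1ℤ
  p-1≈-1 = -≈0 (≈-trans (≡⇒≈ (ℤ.+-comm (+ suc r) 1ℤ)) p≈0)

  homogeneous-distinct : ∀ {x y} → ¬ x ≈ 0ℤ → ¬ y ≈ 0ℤ → ¬ x ≈ y → homogeneous r x y ≈ 0ℤ
  homogeneous-distinct {x} {y} x≉0 y≉0 x≉y = *-cancelˡ (x - y) (x≉y ∘ -≈0) (begin
    (x - y) * homogeneous r x y
      ≈⟨ homogeneous-telescope r x y ⟩
    x ^ suc r - y ^ suc r
      ≈⟨ +-cong (fermat x≉0) (-‿cong (fermat y≉0)) ⟩
    1ℤ - 1ℤ
      ≡⟨ ℤ.*-zeroʳ (x - y) ⟨
    (x - y) * 0ℤ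
      ∎)
    where open ≈-Reasoning

  homogeneous-equal : ∀ {x y} → x ≈ y → homogeneous r x y ≈ - x ^ r
  homogeneous-equal {x} x≈y = ≈-trans (homogeneous-diagonal r x≈y)
    (≈-trans (*ʳ (x ^ r) p-1≈-1) (≡⇒≈ (ℤ.-1*i≡-i (x ^ r))))

  X : Fin (suc r) → ℤ
  X j = rep (suc j)

  -- Since r ≡ -1 modulo p - 1, the exponents stand for -1 - m and -1 + m. They add up to -2, the
  -- degree of the entries of D. As m ≤ r, the subtraction does not truncate.
  V W : Matrix (suc r)
  V i m = X i ^ (r ℕ.∸ toℕ m)
  W m j = X j ^ (r ℕ.+ toℕ m)

  ·-W : ∀ i y (c : Fin (suc r) → ℤ) →
        sum (λ m → V i m * (c m * y ^ (r ℕ.+ toℕ m))) ≈ y ^ r * sum (λ m → V i m * (c m * y ^ toℕ m))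
  ·-W i y c = ≈-trans
    (sum-cong-≋ λ m → ≡⇒≈ (trans (cong (λ z → V i m * (c m * z)) (ℤ.^-distribˡ-+-* y r (toℕ m)))
                                 (lem (V i m) (c m) (y ^ r) (y ^ toℕ m))))
    (≈-sym (*-distribˡ-sum (y ^ r) λ m → V i m * (c m * y ^ toℕ m)))
    where
    lem : ∀ v c a b → v * (c * (a * b)) ≡ a * (v * (c * b))
    lem = solve-∀

  V·W : ∀ i j → (V i · W) j ≈ X j ^ r * homogeneous r (X i) (X j)
  V·W i j = ≈-trans
    (sum-cong-≋ λ m → ≡⇒≈ (cong (V i m *_) (sym (ℤ.*-identityˡ (W m j)))))
    (≈-trans (·-W i (X j) λ _ → 1ℤ)
      (*ˡ (X j ^ r) (sum-cong-≋ λ m → ≡⇒≈ (cong (V i m *_) (ℤ.*-identityˡ (X j ^ toℕ m))))))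

  X-injective : ∀ {i j} → X i ≈ X j → i ≡ j
  X-injective eq = suc-injective (rep-injective eq)

  Q : ℤ
  Q = prod λ j → X j ^ r

  Q≉0 : ¬ Q ≈ 0ℤ
  Q≉0 = prod-nonzero _ λ j → ^-nonzero r (rep-suc≉0 j)

  -1^p-1 : -1ℤ ^ suc r ≈ 1ℤ
  -1^p-1 = fermat λ eq → 1≉0 (-‿cong eq)

  -- The diagonal entries of V · W are - X i^(2r), and the number p - 1 of signs is even.
  det-V*det-W : det V * det W ≈ Q * Q
  det-V*det-W = begin
    det V * det W
      ≡⟨ det-* V W ⟨
    det (λ i → V i · W)
      ≈⟨ det-diagonal (λ i → V i · W) (λ i j i≢j → ≈-trans (V·W i j)
           (≈-trans (*ˡ (X j ^ r) (homogeneous-distinct (rep-suc≉0 i) (rep-suc≉0 j) (i≢j ∘ X-injective)))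
                    (≡⇒≈ (ℤ.*-zeroʳ (X j ^ r))))) ⟩
    prod (λ i → (V i · W) i)
      ≈⟨ prod-cong (λ i → ≈-trans (V·W i i) (≈-trans (*ˡ (X i ^ r) (homogeneous-equal ≈-refl))
           (≡⇒≈ (lem (X i ^ r))))) ⟩
    prod (λ i → -1ℤ * (X i ^ r * X i ^ r))
      ≡⟨ prod-scale -1ℤ (λ i → X i ^ r * X i ^ r) ⟩
    -1ℤ ^ suc r * prod (λ i → X i ^ r * X i ^ r)
      ≈⟨ *-cong -1^p-1 (prod-distrib-* (λ i → X i ^ r) (λ i → X i ^ r)) ⟩
    1ℤ * (Q * Q)
      ≡⟨ ℤ.*-identityˡ (Q * Q) ⟩
    Q * Q
      ∎
    where
    open ≈-Reasoning
    lem : ∀ x → x * (- x) ≡ -1ℤ * (x * x)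
    lem = solve-∀

  -- Power sums and Euler's criterion

  -- If every m-th power were 1, then rows 0 and m of W would agree and det W
  -- would vanish.
  nontrivial-power : ∀ (i : Fin r) → ∃ λ j → ¬ X j ^ suc (toℕ i) ≈ 1ℤ
  nontrivial-power i = ¬∀⟶∃¬ (suc r) _ (λ j → X j ^ suc (toℕ i) ≈? 1ℤ) λ all≈1 →
    *-nonzero Q≉0 Q≉0 (begin
      Q * Q
        ≈⟨ det-V*det-W ⟨
      det V * det W
        ≈⟨ *ˡ (det V) (det-equal-rows W i λ j → begin
             X j ^ (r ℕ.+ 0)
               ≡⟨ ℤ.^-distribˡ-+-* (X j) r 0 ⟩
             X j ^ r * 1ℤ
               ≈⟨ *ˡ (X j ^ r) (all≈1 j) ⟨
             X j ^ r * X j ^ suc (toℕ i)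
               ≡⟨ ℤ.^-distribˡ-+-* (X j) r (suc (toℕ i)) ⟨
             X j ^ (r ℕ.+ suc (toℕ i))
               ∎) ⟩
      det V * 0ℤ
        ≡⟨ ℤ.*-zeroʳ (det V) ⟩
      0ℤ
        ∎)
    where open ≈-Reasoning

  -- For some nonzero v with v^(m+1) ≠ 1, the substitution x ↦ v x multiplies the sum by v^(m+1)
  -- without changing it.
  power-sum : ∀ {m} → m ℕ.< r → ∑ (_^ suc m) ≈ 0ℤ
  power-sum {m} m<r =
    [ ⊥-elim ∘ v^m≉1 ∘ -≈0 , id ]′ (*≈0 (v ^ suc m - 1ℤ) S (begin
      (v ^ suc m - 1ℤ) * S
        ≡⟨ lem (v ^ suc m) S ⟩
      v ^ suc m * S - S
        ≈⟨ +ʳ (- S) (∑-*ˡ (v ^ suc m) (_^ suc m)) ⟨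
      ∑ (λ x → v ^ suc m * x ^ suc m) - S
        ≈⟨ +ʳ (- S) (∑-cong λ x → ≡⇒≈ (^-distribʳ-* v x (suc m))) ⟨
      ∑ (λ x → (v * x) ^ suc m) - S
        ≈⟨ +ʳ (- S) (∑-scale (^-cong (suc m)) (rep-suc≉0 (proj₁ nontrivial))) ⟨
      S - S
        ≡⟨ ℤ.+-inverseʳ S ⟩
      0ℤ
        ∎))
    where
    open ≈-Reasoning
    nontrivial : ∃ λ j → ¬ X j ^ suc (toℕ (fromℕ< m<r)) ≈ 1ℤ
    nontrivial = nontrivial-power (fromℕ< m<r)
    v S : ℤ
    v = X (proj₁ nontrivial)
    S = ∑ (_^ suc m)
    v^m≉1 : ¬ v ^ suc m ≈ 1ℤ
    v^m≉1 = subst (λ l → ¬ v ^ suc l ≈ 1ℤ) (toℕ-fromℕ< m<r) (proj₂ nontrivial)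
    lem : ∀ a s → (a - 1ℤ) * s ≡ a * s - s
    lem = solve-∀

  sum-ones : ∀ m → sum {m} (λ _ → 1ℤ) ≡ + m
  sum-ones ℕ.zero  = refl
  sum-ones (suc m) = cong (_+_ 1ℤ) (sum-ones m)

  ∑-one : ∑ (λ _ → 1ℤ) ≈ 0ℤ
  ∑-one = ≈-trans (≡⇒≈ (sum-ones p)) p≈0

  square-^ : ∀ x m → (x * x) ^ m ≡ x ^ (m ℕ.+ m)
  square-^ x m = trans (^-distribʳ-* x x m) (sym (ℤ.^-distribˡ-+-* x m m))

  ^n-square : ∀ x u → ¬ x ≈ 0ℤ → x * x ≈ u → u ^ n ≈ 1ℤ
  ^n-square x u x≉0 x²≈u =
    ≈-trans (^-cong n (≈-sym x²≈u)) (≈-trans (≡⇒≈ (square-^ x n)) (fermat x≉0))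

  ^n-cases : ∀ {u} → ¬ u ≈ 0ℤ → u ^ n ≈ 1ℤ ⊎ u ^ n ≈ -1ℤ
  ^n-cases {u} u≉0 = [ inj₁ ∘ -≈0 , inj₂ ∘ -≈0 ]′
    (*≈0 (u ^ n - 1ℤ) (u ^ n - -1ℤ) (begin
      (u ^ n - 1ℤ) * (u ^ n - -1ℤ)
        ≡⟨ lem (u ^ n) ⟩
      u ^ n * u ^ n - 1ℤ
        ≡⟨ cong (_- 1ℤ) (ℤ.^-distribˡ-+-* u n n) ⟨
      u ^ (n ℕ.+ n) - 1ℤ
        ≈⟨ ≈⇒-≈0 (fermat u≉0) ⟩
      0ℤ
        ∎))
    where
    open ≈-Reasoning
    lem : ∀ a → (a - 1ℤ) * (a - -1ℤ) ≡ a * a - 1ℤ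
    lem = solve-∀

  -- The exponent 2 m is at most 2 k = p - 3, within reach of `power-sum`. For m = 0 the convention
  -- 0^0 = 1 gives p ones.
  ∑-square-power : ∀ m → m ℕ.≤ k → ∑ (λ x → (x * x) ^ m) ≈ 0ℤ
  ∑-square-power ℕ.zero  _   = ∑-one
  ∑-square-power (suc m) m<k = ≈-trans (∑-cong λ x → ≡⇒≈ (square-^ x (suc m)))
    (power-sum (ℕ.+-mono-< m<k (ℕ.s≤s m<k)))

  -- If u were not a square although u ^ n = 1, then Σₘ (x²)^(k-m) u^m would vanish
  -- for all x ≠ 0, so that its sum over all x would be its value u ^ k at 0;
  -- but every power sum of x² in it vanishes.
  nonsquare⇒^n≉1 : ∀ u → (∀ x → ¬ x * x ≈ u) → ¬ u ^ n ≈ 1ℤ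
  nonsquare⇒^n≉1 u nonsquare u^n≈1 = ^-nonzero k u≉0 (begin
    u ^ k
      ≈⟨ *-cancelˡ (0ℤ - u) (λ eq → u≉0 (≈-sym (-≈0 eq))) (begin
           (0ℤ - u) * H 0ℤ
             ≈⟨ homogeneous-telescope k 0ℤ u ⟩
           0ℤ * 0ℤ ^ k - u * u ^ k
             ≡⟨ lem (0ℤ ^ k) u (u ^ k) ⟩
           (0ℤ - u) * u ^ k
             ∎) ⟨
    H 0ℤ
      ≈⟨ ∑-select H-resp 0ℤ H≈0 ⟨
    ∑ H
      ≈⟨ ∑-comm (λ (i : Fin p) (m : Fin n) → (rep i * rep i) ^ (k ℕ.∸ toℕ m) * u ^ toℕ m) ⟩
    sum (λ (m : Fin n) → ∑ λ x → (x * x) ^ (k ℕ.∸ toℕ m) * u ^ toℕ m)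
      ≈⟨ sum-zero-≈ {n} _ (λ m → begin
           ∑ (λ x → (x * x) ^ (k ℕ.∸ toℕ m) * u ^ toℕ m)
             ≈⟨ ∑-cong (λ x → ≡⇒≈ (ℤ.*-comm ((x * x) ^ (k ℕ.∸ toℕ m)) (u ^ toℕ m))) ⟩
           ∑ (λ x → u ^ toℕ m * (x * x) ^ (k ℕ.∸ toℕ m))
             ≈⟨ ∑-*ˡ (u ^ toℕ m) (λ x → (x * x) ^ (k ℕ.∸ toℕ m)) ⟩
           u ^ toℕ m * ∑ (λ x → (x * x) ^ (k ℕ.∸ toℕ m))
             ≈⟨ *ˡ (u ^ toℕ m) (∑-square-power (k ℕ.∸ toℕ m) (ℕ.m∸n≤m k (toℕ m))) ⟩
           u ^ toℕ m * 0ℤ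
             ≡⟨ ℤ.*-zeroʳ (u ^ toℕ m) ⟩
           0ℤ
             ∎) ⟩
    0ℤ
      ∎)
    where
    open ≈-Reasoning
    H : ℤ → ℤ
    H x = homogeneous k (x * x) u
    u≉0 : ¬ u ≈ 0ℤ
    u≉0 u≈0 = nonsquare 0ℤ (≈-sym u≈0)
    lem : ∀ a u b → 0ℤ * a - u * b ≡ (0ℤ - u) * b
    lem = solve-∀
    H-resp : Respectful H
    H-resp x≈y = sum-cong-≋ {n} λ m → *ʳ (u ^ toℕ m) (^-cong (k ℕ.∸ toℕ m) (*-cong x≈y x≈y))
    H≈0 : ∀ x → ¬ x ≈ 0ℤ → H x ≈ 0ℤ
    H≈0 x x≉0 = *-cancelˡ (x * x - u) (nonsquare x ∘ -≈0) (begin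
      (x * x - u) * H x
        ≈⟨ homogeneous-telescope k (x * x) u ⟩
      (x * x) ^ n - u ^ n
        ≈⟨ +-cong (^n-square x (x * x) x≉0 ≈-refl) (-‿cong u^n≈1) ⟩
      1ℤ - 1ℤ
        ≡⟨ ℤ.*-zeroʳ (x * x - u) ⟨
      (x * x - u) * 0ℤ
        ∎)

  nonsquare⇒^n≈-1 : ∀ u → (∀ x → ¬ x * x ≈ u) → u ^ n ≈ -1ℤ
  nonsquare⇒^n≈-1 u nonsquare =
    [ ⊥-elim ∘ nonsquare⇒^n≉1 u nonsquare , id ]′ (^n-cases (λ u≈0 → nonsquare 0ℤ (≈-sym u≈0)))

  -- The values of the Legendre symbol. As p > 2 they are pairwise incongruent, so a congruence
  -- between products of symbols is already an equality of integers.
  data Ternary : ℤ → Set where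
    zero : Ternary 0ℤ
    one  : Ternary 1ℤ
    neg  : Ternary -1ℤ

  Ternary-* : ∀ {x y} → Ternary x → Ternary y → Ternary (x * y)
  Ternary-* zero b    = zero
  Ternary-* one  zero = zero
  Ternary-* one  one  = one
  Ternary-* one  neg  = neg
  Ternary-* neg  zero = zero
  Ternary-* neg  one  = neg
  Ternary-* neg  neg  = one

  Ternary-^ : ∀ m {x} → Ternary x → Ternary (x ^ m)
  Ternary-^ ℕ.zero  _ = one
  Ternary-^ (suc m) t = Ternary-* t (Ternary-^ m t)

  Ternary-≈⇒≡ : ∀ {x y} → Ternary x → Ternary y → x ≈ y → x ≡ y
  Ternary-≈⇒≡ zero zero _  = refl
  Ternary-≈⇒≡ zero one  eq = ⊥-elim (1≉0 (≈-sym eq))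
  Ternary-≈⇒≡ zero neg  eq = ⊥-elim (1≉0 (≈-sym (-‿cong eq)))
  Ternary-≈⇒≡ one  zero eq = ⊥-elim (1≉0 eq)
  Ternary-≈⇒≡ one  one  _  = refl
  Ternary-≈⇒≡ one  neg  eq = ⊥-elim (2≉0 (+ʳ 1ℤ eq))
  Ternary-≈⇒≡ neg  zero eq = ⊥-elim (1≉0 (-‿cong eq))
  Ternary-≈⇒≡ neg  one  eq = ⊥-elim (2≉0 (≈-sym (+ʳ 1ℤ eq)))
  Ternary-≈⇒≡ neg  neg  _  = refl

  isSquareMod⇒ : ∀ {a} → IsSquareMod p a → ∃ λ x → x * x ≈ a
  isSquareMod⇒ (i , eq) = rep i , ≈-trans (≡⇒≈ (sym (cong (rep i *_) (ℤ.*-identityʳ (rep i))))) (mod eq)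

  ⇒isSquareMod : ∀ {a} x → x * x ≈ a → IsSquareMod p a
  ⇒isSquareMod {a} x x²≈a = residue x , _≈_.unmod (begin
    rep (residue x) * (rep (residue x) * 1ℤ)
      ≡⟨ cong (rep (residue x) *_) (ℤ.*-identityʳ (rep (residue x))) ⟩
    rep (residue x) * rep (residue x)
      ≈⟨ *-cong (rep-residue x) (rep-residue x) ⟩
    x * x
      ≈⟨ x²≈a ⟩
    a
      ∎)
    where open ≈-Reasoning

  legendre-nonzero : ∀ {a} → ¬ a ≈ 0ℤ → legendre p a ≡ (if does (isSquareMod? p a) then 1ℤ else -1ℤ)
  legendre-nonzero {a} a≉0 =
    cong (if_then 0ℤ else if does (isSquareMod? p a) then 1ℤ else -1ℤ)
         (dec-false (+ p ∣? a) (a≉0 ∘ ∣⇒≈0))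

  euler : ∀ a → Ternary (legendre p a) × legendre p a ≈ a ^ n
  euler a = by-cases (a ≈? 0ℤ) (isSquareMod? p a)
    where
    value : ∀ {l} → legendre p a ≡ l → Ternary l → l ≈ a ^ n → Ternary (legendre p a) × legendre p a ≈ a ^ n
    value eq t l≈ = subst Ternary (sym eq) t , ≈-trans (≡⇒≈ eq) l≈
    by-cases : Dec (a ≈ 0ℤ) → Dec (IsSquareMod p a) → Ternary (legendre p a) × legendre p a ≈ a ^ n
    by-cases (yes a≈0) _ = value
      (cong (if_then 0ℤ else if does (isSquareMod? p a) then 1ℤ else -1ℤ) (dec-true (+ p ∣? a) (≈0⇒∣ a≈0)))
      zero (≈-sym (^-zero k a≈0))
    by-cases (no a≉0) (yes sq) = value
      (trans (legendre-nonzero a≉0) (cong (if_then 1ℤ else -1ℤ) (dec-true (isSquareMod? p a) sq)))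
      one (let x , x²≈a = isSquareMod⇒ sq in
           ≈-sym (^n-square x a (λ x≈0 → a≉0 (≈-trans (≈-sym x²≈a) (*ʳ x x≈0))) x²≈a))
    by-cases (no a≉0) (no ¬sq) = value
      (trans (legendre-nonzero a≉0) (cong (if_then 1ℤ else -1ℤ) (dec-false (isSquareMod? p a) ¬sq)))
      neg (≈-sym (nonsquare⇒^n≈-1 a λ x x²≈a → ¬sq (⇒isSquareMod x x²≈a)))

  -- The determinant as a product of the sums T

  quad : ℤ → ℤ → ℤ → ℤ
  quad a b t = t * t + a * t + b

  quad-resp : ∀ a b → Respectful (quad a b)
  quad-resp a b t≈u = +ʳ b (+-cong (*-cong t≈u t≈u) (*ˡ a t≈u))

  -- Up to the factor -1 = 1 / (p - 1), the coefficient of t^(-1-m) in the expansion of 1 / (t² + a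
  -- t + b) into powers of nonzero t; hence the exponent m + 1.
  T : ℤ → ℤ → ℕ → ℤ
  T a b m = ∑ λ t → quad a b t ^ r * t ^ suc m

  -- D = V · diag (-T) · W, because ∑ₘ V i m (y t) ^ m is supported on t = x / y,
  -- where x = X i and y = X j.
  D-factorization : ∀ a b i j →
    D p a b i j ≈ (V i · λ m l → -1ℤ * T a b (toℕ m) * W m l) j
  D-factorization a b i j = ≈-sym (begin
    sum (λ m → V i m * (-1ℤ * T a b (toℕ m) * y ^ (r ℕ.+ toℕ m)))
      ≈⟨ ·-W i y (λ m → -1ℤ * T a b (toℕ m)) ⟩
    y ^ r * sum (λ m → V i m * (-1ℤ * T a b (toℕ m) * y ^ toℕ m))
      ≈⟨ *ˡ (y ^ r) (begin
           sum (λ m → V i m * (-1ℤ * T a b (toℕ m) * y ^ toℕ m))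
             ≈⟨ sum-cong-≋ {suc r} (λ m → begin
                  V i m * (-1ℤ * T a b (toℕ m) * y ^ toℕ m)
                    ≡⟨ lem₁ (V i m) (T a b (toℕ m)) (y ^ toℕ m) ⟩
                  -1ℤ * y ^ toℕ m * V i m * T a b (toℕ m)
                    ≈⟨ ∑-*ˡ (-1ℤ * y ^ toℕ m * V i m) (λ t → quad a b t ^ r * t ^ suc (toℕ m)) ⟨
                  ∑ (λ t → -1ℤ * y ^ toℕ m * V i m * (quad a b t ^ r * t ^ suc (toℕ m)))
                    ≈⟨ ∑-cong (λ t → ≡⇒≈ (trans (lem₂ (y ^ toℕ m) (V i m) (quad a b t ^ r) t (t ^ toℕ m))
                         (cong (λ z → G t * (V i m * z)) (sym (^-distribʳ-* y t (toℕ m)))))) ⟩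
                  ∑ (λ t → G t * (V i m * (y * t) ^ toℕ m))
                    ∎) ⟩
           sum (λ (m : Fin (suc r)) → ∑ (λ t → G t * (V i m * (y * t) ^ toℕ m)))
             ≈⟨ ∑-comm {suc r} {p} (λ m t → G (rep t) * (V i m * (y * rep t) ^ toℕ m)) ⟩
           ∑ (λ t → sum (λ (m : Fin (suc r)) → G t * (V i m * (y * t) ^ toℕ m)))
             ≈⟨ ∑-cong (λ t → *-distribˡ-sum (G t) λ (m : Fin (suc r)) → V i m * (y * t) ^ toℕ m) ⟨
           ∑ F
             ≈⟨ ∑-select F-resp t₀ F≈0 ⟩
           F t₀
             ∎) ⟩
    y ^ r * (-1ℤ * quad a b t₀ ^ r * t₀ * homogeneous r x (y * t₀))
      ≈⟨ *ˡ (y ^ r) (*ˡ (G t₀) (≈-trans (homogeneous-equal (≈-sym yt₀≈x)) (-‿cong (^-cong r (≈-sym yt₀≈x))))) ⟩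
    y ^ r * (-1ℤ * quad a b t₀ ^ r * t₀ * - (y * t₀) ^ r)
      ≡⟨ cong (λ z → y ^ r * (-1ℤ * quad a b t₀ ^ r * t₀ * - z)) (^-distribʳ-* y t₀ r) ⟩
    y ^ r * (-1ℤ * quad a b t₀ ^ r * t₀ * - (y ^ r * t₀ ^ r))
      ≡⟨ lem₃ (y ^ r) (quad a b t₀ ^ r) t₀ (t₀ ^ r) ⟩
    t₀ * t₀ ^ r * (y ^ r * y ^ r * quad a b t₀ ^ r)
      ≈⟨ *ʳ (y ^ r * y ^ r * quad a b t₀ ^ r) (inverseʳ t₀≉0) ⟩
    1ℤ * (y ^ r * y ^ r * quad a b t₀ ^ r)
      ≡⟨ trans (ℤ.*-identityˡ _) (sym (trans (^-distribʳ-* (y * y) (quad a b t₀) r)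
           (cong (_* quad a b t₀ ^ r) (^-distribʳ-* y y r)))) ⟩
    (y * y * quad a b t₀) ^ r
      ≡⟨ cong (_^ r) (lem₄ y t₀ a b) ⟩
    ((y * t₀) * ((y * t₀) * 1ℤ) + a * (y * t₀) * y + b * (y * (y * 1ℤ))) ^ r
      ≈⟨ ^-cong r (+ʳ (b * (y * (y * 1ℤ)))
           (+-cong (*-cong yt₀≈x (*ʳ 1ℤ yt₀≈x)) (*ʳ y (*ˡ a yt₀≈x)))) ⟩
    (x * (x * 1ℤ) + a * x * y + b * (y * (y * 1ℤ))) ^ r
      ∎)
    where
    open ≈-Reasoning
    x y t₀ : ℤ
    x = X i
    y = X j
    t₀ = x * inv y
    yt₀≈x : y * t₀ ≈ x
    yt₀≈x = ≈-trans (≡⇒≈ (swap′ y x (inv y))) (≈-trans (*ˡ x (inverseʳ (rep-suc≉0 j))) (≡⇒≈ (ℤ.*-identityʳ x)))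
      where
      swap′ : ∀ y x z → y * (x * z) ≡ x * (y * z)
      swap′ = solve-∀
    t₀≉0 : ¬ t₀ ≈ 0ℤ
    t₀≉0 = *-nonzero (rep-suc≉0 i) (inv-nonzero (rep-suc≉0 j))
    G F : ℤ → ℤ
    G t = -1ℤ * quad a b t ^ r * t
    F t = G t * homogeneous r x (y * t)
    F-resp : Respectful F
    F-resp t≈u = *-cong (*-cong (*ˡ -1ℤ (^-cong r (quad-resp a b t≈u))) t≈u)
      (sum-cong-≋ {suc r} λ m → *ˡ (V i m) (^-cong (toℕ m) (*ˡ y t≈u)))
    F≈0 : ∀ t → ¬ t ≈ t₀ → F t ≈ 0ℤ
    F≈0 t t≉t₀ = by-cases (t ≈? 0ℤ)
      where
      by-cases : Dec (t ≈ 0ℤ) → F t ≈ 0ℤ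
      by-cases (yes t≈0) = ≈-trans (*ʳ (homogeneous r x (y * t)) (*ˡ (-1ℤ * quad a b t ^ r) t≈0))
        (≡⇒≈ (vanish (-1ℤ * quad a b t ^ r) (homogeneous r x (y * t))))
        where
        vanish : ∀ u v → u * 0ℤ * v ≡ 0ℤ
        vanish = solve-∀
      by-cases (no t≉0) = ≈-trans
        (*ˡ (G t) (homogeneous-distinct (rep-suc≉0 i) (*-nonzero (rep-suc≉0 j) t≉0)
          λ x≈yt → t≉t₀ (*-cancelˡ y (rep-suc≉0 j) (≈-trans (≈-sym x≈yt) (≈-sym yt₀≈x)))))
        (≡⇒≈ (ℤ.*-zeroʳ (G t)))
    lem₁ : ∀ v t y → v * (-1ℤ * t * y) ≡ -1ℤ * y * v * t
    lem₁ = solve-∀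
    lem₂ : ∀ ym v g t tm → -1ℤ * ym * v * (g * (t * tm)) ≡ -1ℤ * g * t * (v * (ym * tm))
    lem₂ = solve-∀
    lem₃ : ∀ y g t t′ → y * (-1ℤ * g * t * - (y * t′)) ≡ t * t′ * (y * y * g)
    lem₃ = solve-∀
    lem₄ : ∀ y t a b → y * y * (t * t + a * t + b)
         ≡ y * t * (y * t * 1ℤ) + a * (y * t) * y + b * (y * (y * 1ℤ))
    lem₄ = solve-∀

  det-D : ∀ a b → det (D p a b) ≈ Q * Q * prod λ (m : Fin (suc r)) → T a b (toℕ m)
  det-D a b = begin
    det (D p a b)
      ≈⟨ det-cong-≈ {A = D p a b} {B = λ i → V i · CW} (D-factorization a b) ⟩
    det (λ i → V i · CW)
      ≡⟨ det-* V CW ⟩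
    det V * det CW
      ≈⟨ *ˡ (det V) (det-scale-rows (λ m → -1ℤ * T a b (toℕ m)) W) ⟩
    det V * (prod (λ (m : Fin (suc r)) → -1ℤ * T a b (toℕ m)) * det W)
      ≡⟨ cong (λ z → det V * (z * det W)) (prod-scale -1ℤ λ (m : Fin (suc r)) → T a b (toℕ m)) ⟩
    det V * (-1ℤ ^ suc r * P * det W)
      ≡⟨ lem (det V) (-1ℤ ^ suc r) P (det W) ⟩
    -1ℤ ^ suc r * (det V * det W * P)
      ≈⟨ *-cong -1^p-1 (*ʳ P det-V*det-W) ⟩
    1ℤ * (Q * Q * P)
      ≡⟨ ℤ.*-identityˡ (Q * Q * P) ⟩
    Q * Q * P
      ∎
    where
    open ≈-Reasoning
    CW : Matrix (suc r)
    CW m l = -1ℤ * T a b (toℕ m) * W m l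
    P : ℤ
    P = prod λ (m : Fin (suc r)) → T a b (toℕ m)
    lem : ∀ v s p w → v * (s * p * w) ≡ s * (v * w * p)
    lem = solve-∀

  prodTo : ℕ → (ℕ → ℤ) → ℤ
  prodTo N f = prod λ (i : Fin N) → f (toℕ i)

  prodTo-last : ∀ N f → prodTo (suc N) f ≡ prodTo N f * f N
  prodTo-last ℕ.zero  f = ℤ.*-comm (f 0) 1ℤ
  prodTo-last (suc N) f = trans (cong (f 0 *_) (prodTo-last N (f ∘ suc)))
    (sym (ℤ.*-assoc (f 0) (prodTo N (f ∘ suc)) (f (suc N))))

  -- The two outermost factors coincide and contribute a square; only the middle one has no partner.
  palindrome : ∀ l f → (∀ i j → i ℕ.+ j ≡ l ℕ.+ l → f i ≈ f j) →
               ∃ λ R → prodTo (suc (l ℕ.+ l)) f ≈ R * R * f l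
  palindrome ℕ.zero  f f-sym = 1ℤ , ≡⇒≈ (lem (f 0))
    where
    lem : ∀ x → x * 1ℤ ≡ 1ℤ * 1ℤ * x
    lem = solve-∀
  palindrome (suc l) f f-sym = f 0 * R , (begin
    f 0 * prodTo (suc (l ℕ.+ suc l)) (f ∘ suc)
      ≡⟨ cong (λ N → f 0 * prodTo (suc N) (f ∘ suc)) (ℕ.+-suc l l) ⟩
    f 0 * prodTo (suc (suc (l ℕ.+ l))) (f ∘ suc)
      ≡⟨ cong (f 0 *_) (prodTo-last (suc (l ℕ.+ l)) (f ∘ suc)) ⟩
    f 0 * (prodTo (suc (l ℕ.+ l)) (f ∘ suc) * f (suc (suc (l ℕ.+ l))))
      ≈⟨ *ˡ (f 0) (*-cong (proj₂ inner) (≈-sym (f-sym 0 (suc (suc (l ℕ.+ l))) (cong suc (sym (ℕ.+-suc l l)))))) ⟩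
    f 0 * (R * R * f (suc l) * f 0)
      ≡⟨ lem (f 0) R (f (suc l)) ⟩
    f 0 * R * (f 0 * R) * f (suc l)
      ∎)
    where
    open ≈-Reasoning
    inner : ∃ λ R → prodTo (suc (l ℕ.+ l)) (f ∘ suc) ≈ R * R * f (suc l)
    inner = palindrome l (f ∘ suc) λ i j i+j≡ → f-sym (suc i) (suc j) (cong suc
      (trans (ℕ.+-suc i j) (trans (cong suc i+j≡) (sym (ℕ.+-suc l l)))))
    R : ℤ
    R = proj₁ inner
    lem : ∀ a R m → a * (R * R * m * a) ≡ a * R * (a * R) * m
    lem = solve-∀

  sym-sum : ℤ → ℤ
  sym-sum t = t + inv t

  sym-sum-resp : Respectful sym-sum
  sym-sum-resp t≈u = +-cong t≈u (inv-resp t≈u)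

  -- Here t² + c t + 1 = t (t + t⁻¹ + c), and the factor t cancels one power. The index must be
  -- positive: at index 0 the right side would have a nonvanishing term at t = 0 whenever c ≠ 0.
  T-suc : ∀ c m → T c 1ℤ (suc m) ≈ ∑ λ t → t ^ suc m * (sym-sum t + c) ^ r
  T-suc c m = ∑-cong λ t → by-cases t (t ≈? 0ℤ)
    where
    open ≈-Reasoning
    by-cases : ∀ t → Dec (t ≈ 0ℤ) → quad c 1ℤ t ^ r * t ^ suc (suc m) ≈ t ^ suc m * (sym-sum t + c) ^ r
    by-cases t (yes t≈0) = ≈-trans (*ˡ (quad c 1ℤ t ^ r) (^-zero (suc m) t≈0))
      (≈-trans (≡⇒≈ (ℤ.*-zeroʳ (quad c 1ℤ t ^ r))) (≈-sym (*ʳ ((sym-sum t + c) ^ r) (^-zero m t≈0))))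
    by-cases t (no t≉0) = begin
      quad c 1ℤ t ^ r * t ^ suc (suc m)
        ≈⟨ *ʳ (t ^ suc (suc m)) (^-cong r (+ˡ (t * t + c * t) (≈-sym (inverseʳ t≉0)))) ⟩
      (t * t + c * t + t * inv t) ^ r * t ^ suc (suc m)
        ≡⟨ cong (λ z → z ^ r * t ^ suc (suc m)) (lem₁ t c (inv t)) ⟩
      (t * (sym-sum t + c)) ^ r * t ^ suc (suc m)
        ≡⟨ cong (_* t ^ suc (suc m)) (^-distribʳ-* t (sym-sum t + c) r) ⟩
      t ^ r * (sym-sum t + c) ^ r * (t * t ^ suc m)
        ≡⟨ lem₂ (t ^ r) ((sym-sum t + c) ^ r) t (t ^ suc m) ⟩
      t * t ^ r * (t ^ suc m * (sym-sum t + c) ^ r)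
        ≈⟨ *ʳ (t ^ suc m * (sym-sum t + c) ^ r) (inverseʳ t≉0) ⟩
      1ℤ * (t ^ suc m * (sym-sum t + c) ^ r)
        ≡⟨ ℤ.*-identityˡ (t ^ suc m * (sym-sum t + c) ^ r) ⟩
      t ^ suc m * (sym-sum t + c) ^ r
        ∎
      where
      lem₁ : ∀ t c i → t * t + c * t + t * i ≡ t * (t + i + c)
      lem₁ = solve-∀
      lem₂ : ∀ a s t b → a * s * (t * b) ≡ t * a * (b * s)
      lem₂ = solve-∀

  T-sym : ∀ c i j → suc (i ℕ.+ suc j) ≡ suc r → T c 1ℤ (suc i) ≈ T c 1ℤ (suc j)
  T-sym c i j i+j = begin
    T c 1ℤ (suc i)
      ≈⟨ T-suc c i ⟩
    ∑ F
      ≈⟨ ∑-inv F-resp ⟩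
    ∑ (λ t → inv t ^ suc i * (sym-sum (inv t) + c) ^ r)
      ≈⟨ ∑-cong (λ t → *-cong (by-cases t (t ≈? 0ℤ)) (^-cong r (+ʳ c (≈-trans
           (+ˡ (inv t) (inv-involutive t)) (≡⇒≈ (ℤ.+-comm (inv t) t)))))) ⟩
    ∑ (λ t → t ^ suc j * (sym-sum t + c) ^ r)
      ≈⟨ T-suc c j ⟨
    T c 1ℤ (suc j)
      ∎
    where
    open ≈-Reasoning
    F : ℤ → ℤ
    F t = t ^ suc i * (sym-sum t + c) ^ r
    F-resp : Respectful F
    F-resp t≈u = *-cong (^-cong (suc i) t≈u) (^-cong r (+ʳ c (sym-sum-resp t≈u)))
    by-cases : ∀ t → Dec (t ≈ 0ℤ) → inv t ^ suc i ≈ t ^ suc j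
    by-cases t (yes t≈0) = ≈-trans (^-zero i (inv-zero t≈0)) (≈-sym (^-zero j t≈0))
    by-cases t (no t≉0) = inverse-unique (t ^ suc i)
      (begin
        t ^ suc i * inv t ^ suc i
          ≡⟨ ^-distribʳ-* t (inv t) (suc i) ⟨
        (t * inv t) ^ suc i
          ≈⟨ ^-cong (suc i) (inverseʳ t≉0) ⟩
        1ℤ ^ suc i
          ≡⟨ ℤ.^-zeroˡ (suc i) ⟩
        1ℤ
          ∎)
      (begin
        t ^ suc i * t ^ suc j
          ≡⟨ ℤ.^-distribˡ-+-* t (suc i) (suc j) ⟨
        t ^ suc (i ℕ.+ suc j)
          ≡⟨ cong (t ^_) i+j ⟩
        t ^ suc r
          ≈⟨ fermat t≉0 ⟩
        1ℤ
          ∎)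

  -- The r = 2 k + 1 indices 1, ..., p - 2 form a palindrome with middle n. Index 0 stays alone,
  -- because its partner p - 1 lies outside the range.
  det-D-square-class : ∀ c → ∃ λ R → det (D p c 1ℤ) ≈ R * R * (T c 1ℤ 0 * T c 1ℤ n)
  det-D-square-class c = Q * R , (begin
    det (D p c 1ℤ)
      ≈⟨ det-D c 1ℤ ⟩
    Q * Q * (T c 1ℤ 0 * prodTo r (T c 1ℤ ∘ suc))
      ≡⟨ cong (λ N → Q * Q * (T c 1ℤ 0 * prodTo N (T c 1ℤ ∘ suc))) r≡ ⟩
    Q * Q * (T c 1ℤ 0 * prodTo (suc (k ℕ.+ k)) (T c 1ℤ ∘ suc))
      ≈⟨ *ˡ (Q * Q) (*ˡ (T c 1ℤ 0) (proj₂ half)) ⟩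
    Q * Q * (T c 1ℤ 0 * (R * R * T c 1ℤ n))
      ≡⟨ lem Q (T c 1ℤ 0) R (T c 1ℤ n) ⟩
    Q * R * (Q * R) * (T c 1ℤ 0 * T c 1ℤ n)
      ∎)
    where
    open ≈-Reasoning
    half : ∃ λ R → prodTo (suc (k ℕ.+ k)) (T c 1ℤ ∘ suc) ≈ R * R * T c 1ℤ n
    half = palindrome k (T c 1ℤ ∘ suc) λ i j i+j≡ → T-sym c i j
      (cong suc (trans (ℕ.+-suc i j) (trans (cong suc i+j≡) (sym r≡))))
    R : ℤ
    R = proj₁ half
    lem : ∀ q a R b → q * q * (a * (R * R * b)) ≡ q * R * (q * R) * (a * b)
    lem = solve-∀

  -- Sums over the fibres of x² and of t + t⁻¹

  -- Writing F (φ t) as a δ-sum over s turns the grouping by fibres of φ into an exchange of two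
  -- sums.
  ∑-fibre : ∀ (w φ F : ℤ → ℤ) → Respectful F →
            ∑ (λ t → w t * F (φ t)) ≈ ∑ (λ s → F s * ∑ (λ t → w t * δ (s - φ t)))
  ∑-fibre w φ F F-resp = begin
    ∑ (λ t → w t * F (φ t))
      ≈⟨ ∑-cong (λ t → *ˡ (w t) (∑-δ F-resp (φ t))) ⟨
    ∑ (λ t → w t * ∑ (λ s → F s * δ (s - φ t)))
      ≈⟨ ∑-cong (λ t → ∑-*ˡ (w t) (λ s → F s * δ (s - φ t))) ⟨
    ∑ (λ t → ∑ (λ s → w t * (F s * δ (s - φ t))))
      ≈⟨ ∑-comm′ (λ t s → w t * (F s * δ (s - φ t))) ⟩
    ∑ (λ s → ∑ (λ t → w t * (F s * δ (s - φ t))))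
      ≈⟨ ∑-cong (λ s → ≈-trans (∑-cong λ t → ≡⇒≈ (lem (w t) (F s) (δ (s - φ t))))
                               (∑-*ˡ (F s) (λ t → w t * δ (s - φ t)))) ⟩
    ∑ (λ s → F s * ∑ (λ t → w t * δ (s - φ t)))
      ∎
    where
    open ≈-Reasoning
    lem : ∀ w f d → w * (f * d) ≡ f * (w * d)
    lem = solve-∀

  x≈-x⇒x≈0 : ∀ {x} → x ≈ - x → x ≈ 0ℤ
  x≈-x⇒x≈0 {x} eq = *-cancelˡ (+ 2) 2≉0 (≈-trans (≡⇒≈ (lem x)) (≈-trans (+ʳ x eq) (≡⇒≈ (ℤ.+-inverseˡ x))))
    where
    lem : ∀ x → + 2 * x ≡ x + x
    lem = solve-∀

  δ-weight-resp : ∀ {w φ} → Respectful w → Respectful φ → ∀ s → Respectful λ t → w t * δ (s - φ t)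
  δ-weight-resp w-resp φ-resp s t≈u = *-cong (w-resp t≈u) (δ-resp (+ˡ s (-‿cong (φ-resp t≈u))))

  δ-weight-on : ∀ (w φ : ℤ → ℤ) {s} t → s ≈ φ t → w t * δ (s - φ t) ≈ w t
  δ-weight-on w φ t s≈φt = ≈-trans (*ˡ (w t) (δ-zero (≈⇒-≈0 s≈φt))) (≡⇒≈ (ℤ.*-identityʳ (w t)))

  δ-weight-off : ∀ (w φ : ℤ → ℤ) {s} t → ¬ s ≈ φ t → w t * δ (s - φ t) ≈ 0ℤ
  δ-weight-off w φ t s≉φt = ≈-trans (*ˡ (w t) (δ-nonzero (s≉φt ∘ -≈0))) (≡⇒≈ (ℤ.*-zeroʳ (w t)))

  -- Two, one or no square roots correspond to u^n = 1, 0, -1. The weight `1ℤ` keeps the shape of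
  -- `∑-fibre`.
  sqrt-count : ∀ u → ∑ (λ x → 1ℤ * δ (u - x * x)) ≈ 1ℤ + u ^ n
  sqrt-count u = by-cases (isSquareMod? p u)
    where
    open ≈-Reasoning
    sq : ℤ → ℤ
    sq x = x * x
    weight-resp : Respectful λ x → 1ℤ * δ (u - x * x)
    weight-resp = δ-weight-resp {w = λ _ → 1ℤ} {sq} (λ _ → ≈-refl) (λ x≈y → *-cong x≈y x≈y) u
    on : ∀ x → u ≈ x * x → 1ℤ * δ (u - x * x) ≈ 1ℤ
    on = δ-weight-on (λ _ → 1ℤ) sq
    off : ∀ x → ¬ u ≈ x * x → 1ℤ * δ (u - x * x) ≈ 0ℤ
    off = δ-weight-off (λ _ → 1ℤ) sq
    factor : ∀ x y → (x - y) * (x - - y) ≡ x * x - y * y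
    factor = solve-∀
    neg-square : ∀ y → y * y ≡ - y * - y
    neg-square = solve-∀
    roots : ∀ {y} → u ≈ y * y → ∀ x → u ≈ x * x → x ≈ y ⊎ x ≈ - y
    roots {y} u≈y² x u≈x² = [ inj₁ ∘ -≈0 , inj₂ ∘ -≈0 ]′ (*≈0 (x - y) (x - - y)
      (≈-trans (≡⇒≈ (factor x y)) (≈⇒-≈0 (≈-trans (≈-sym u≈x²) u≈y²))))
    square : ∀ y → y * y ≈ u → Dec (y ≈ 0ℤ) → ∑ (λ x → 1ℤ * δ (u - x * x)) ≈ 1ℤ + u ^ n
    square y y²≈u (yes y≈0) = begin
      ∑ (λ x → 1ℤ * δ (u - x * x))
        ≈⟨ ∑-select weight-resp y (λ x x≉y → off x λ u≈x² →
             [ x≉y , (λ x≈-y → x≉y (≈-trans x≈-y (≈-trans (-‿cong y≈0) (≈-sym y≈0)))) ]′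
             (roots (≈-sym y²≈u) x u≈x²)) ⟩
      1ℤ * δ (u - y * y)
        ≈⟨ on y (≈-sym y²≈u) ⟩
      1ℤ + 0ℤ
        ≈⟨ +ˡ 1ℤ (^-zero k (≈-trans (≈-sym y²≈u) (*-cong y≈0 y≈0))) ⟨
      1ℤ + u ^ n
        ∎
    square y y²≈u (no y≉0) = begin
      ∑ (λ x → 1ℤ * δ (u - x * x))
        ≈⟨ ∑-select₂ weight-resp y (- y) (y≉0 ∘ x≈-x⇒x≈0) (λ x x≉y x≉-y → off x λ u≈x² →
             [ x≉y , x≉-y ]′ (roots (≈-sym y²≈u) x u≈x²)) ⟩
      1ℤ * δ (u - y * y) + 1ℤ * δ (u - - y * - y)
        ≈⟨ +-cong (on y (≈-sym y²≈u)) (on (- y) (≈-trans (≈-sym y²≈u) (≡⇒≈ (neg-square y)))) ⟩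
      1ℤ + 1ℤ
        ≈⟨ +ˡ 1ℤ (^n-square y u y≉0 y²≈u) ⟨
      1ℤ + u ^ n
        ∎
    by-cases : Dec (IsSquareMod p u) → ∑ (λ x → 1ℤ * δ (u - x * x)) ≈ 1ℤ + u ^ n
    by-cases (yes is-square) =
      let y , y²≈u = isSquareMod⇒ is-square in square y y²≈u (y ≈? 0ℤ)
    by-cases (no nonsquare) = begin
      ∑ (λ x → 1ℤ * δ (u - x * x))
        ≈⟨ sum-zero-≈ {p} _ (λ i → off (rep i) λ u≈x² → nonsquare (⇒isSquareMod (rep i) (≈-sym u≈x²))) ⟩
      1ℤ + -1ℤ
        ≈⟨ +ˡ 1ℤ (nonsquare⇒^n≈-1 u λ x x²≈u → nonsquare (⇒isSquareMod x x²≈u)) ⟨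
      1ℤ + u ^ n
        ∎

  ∑-squares : ∀ F → Respectful F → ∑ (λ x → F (x * x)) ≈ ∑ (λ u → F u * (1ℤ + u ^ n))
  ∑-squares F F-resp = ≈-trans
    (∑-cong λ x → ≡⇒≈ (sym (ℤ.*-identityˡ (F (x * x)))))
    (≈-trans (∑-fibre (λ _ → 1ℤ) (λ x → x * x) F F-resp)
             (∑-cong λ u → *ˡ (F u) (sqrt-count u)))

  ^n-±1 : ∀ {x} → ¬ x ≈ 0ℤ → x ^ n * x ^ n ≈ 1ℤ
  ^n-±1 {x} x≉0 = ≈-trans (≡⇒≈ (sym (ℤ.^-distribˡ-+-* x n n))) (fermat x≉0)

  square-^n : ∀ {x} → ¬ x ≈ 0ℤ → (x * x) ^ n ≈ 1ℤ
  square-^n {x} x≉0 = ^n-square x (x * x) x≉0 ≈-refl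

  -- A solution ρ of t + t⁻¹ = s satisfies ρ (s ± 2) = (ρ ± 1)²; if there is none,
  -- then s² - 4 is not a square.
  sym-sum-count : ∀ s → ∑ (λ t → t ^ n * δ (s - sym-sum t)) ≈ (s + + 2) ^ n + (s - + 2) ^ n
  sym-sum-count s = by-cases (any? λ i → rep i * rep i + 1ℤ ≈? s * rep i)
    where
    open ≈-Reasoning
    weight : ℤ → ℤ
    weight t = t ^ n * δ (s - sym-sum t)
    weight-resp : Respectful weight
    weight-resp = δ-weight-resp (^-cong n) sym-sum-resp s
    on : ∀ t → s ≈ sym-sum t → weight t ≈ t ^ n
    on = δ-weight-on (_^ n) sym-sum
    -- As `inv` sends 0 to 0, the point t = 0 lies in the fibre of s = 0 although it solves no
    -- equation t + t⁻¹ = s; the weight 0^n = 0 discards it.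
    off : ∀ t → (¬ t ≈ 0ℤ → ¬ s ≈ sym-sum t) → weight t ≈ 0ℤ
    off t s≉ = off′ (t ≈? 0ℤ)
      where
      off′ : Dec (t ≈ 0ℤ) → weight t ≈ 0ℤ
      off′ (yes t≈0) = *ʳ (δ (s - sym-sum t)) (^-zero k t≈0)
      off′ (no  t≉0) = δ-weight-off (_^ n) sym-sum t (s≉ t≉0)
    equation : ∀ {t} → ¬ t ≈ 0ℤ → s ≈ sym-sum t → t * t + 1ℤ ≈ s * t
    equation {t} t≉0 s≈ = begin
      t * t + 1ℤ
        ≈⟨ +ˡ (t * t) (inverseʳ t≉0) ⟨
      t * t + t * inv t
        ≡⟨ lem t (inv t) ⟩
      (t + inv t) * t
        ≈⟨ *ʳ t s≈ ⟨
      s * t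
        ∎
      where
      lem : ∀ t i → t * t + t * i ≡ (t + i) * t
      lem = solve-∀

    module Root (ρ : ℤ) (ρ-root : ρ * ρ + 1ℤ ≈ s * ρ) where
      ρ≉0 : ¬ ρ ≈ 0ℤ
      ρ≉0 ρ≈0 = 1≉0 (≈-trans (+ʳ 1ℤ (≈-sym (*-cong ρ≈0 ρ≈0)))
                     (≈-trans ρ-root (≈-trans (*ˡ s ρ≈0) (≡⇒≈ (ℤ.*-zeroʳ s)))))
      ρ′ : ℤ
      ρ′ = inv ρ
      ρρ′≈1 : ρ * ρ′ ≈ 1ℤ
      ρρ′≈1 = inverseʳ ρ≉0
      s≈ : s ≈ ρ + ρ′
      s≈ = *-cancelˡ ρ ρ≉0 (begin
        ρ * s
          ≡⟨ ℤ.*-comm ρ s ⟩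
        s * ρ
          ≈⟨ ρ-root ⟨
        ρ * ρ + 1ℤ
          ≈⟨ +ˡ (ρ * ρ) ρρ′≈1 ⟨
        ρ * ρ + ρ * ρ′
          ≡⟨ ℤ.*-distribˡ-+ ρ ρ ρ′ ⟨
        ρ * (ρ + ρ′)
          ∎)
      s≈′ : s ≈ sym-sum ρ′
      s≈′ = ≈-trans s≈ (≈-trans (≡⇒≈ (ℤ.+-comm ρ ρ′)) (+ˡ ρ′ (≈-sym (inv-involutive ρ))))
      roots : ∀ t → t * t + 1ℤ ≈ s * t → t ≈ ρ ⊎ t ≈ ρ′
      roots t t-root = [ inj₁ ∘ -≈0 , inj₂ ∘ -≈0 ]′ (*≈0 (t - ρ) (t - ρ′) (begin
        (t - ρ) * (t - ρ′)
          ≡⟨ lem t ρ ρ′ ⟩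
        t * t + ρ * ρ′ - (ρ + ρ′) * t
          ≈⟨ +-cong (+ˡ (t * t) ρρ′≈1) (-‿cong (*ʳ t (≈-sym s≈))) ⟩
        t * t + 1ℤ - s * t
          ≈⟨ ≈⇒-≈0 t-root ⟩
        0ℤ
          ∎))
        where
        lem : ∀ t a b → (t - a) * (t - b) ≡ t * t + a * b - (a + b) * t
        lem = solve-∀
      ρ^n-self-inverse : ρ ^ n ≈ ρ′ ^ n
      ρ^n-self-inverse = inverse-unique (ρ ^ n) (^n-±1 ρ≉0)
        (≈-trans (≡⇒≈ (sym (^-distribʳ-* ρ ρ′ n))) (≈-trans (^-cong n ρρ′≈1) (≡⇒≈ (ℤ.^-zeroˡ n))))
      shifted : ∀ ε → ε * ε ≡ 1ℤ → ¬ ρ + ε ≈ 0ℤ → (s + + 2 * ε) ^ n ≈ ρ ^ n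
      shifted ε ε²≡1 ρ+ε≉0 = inverse-unique (ρ ^ n) (begin
        ρ ^ n * (s + + 2 * ε) ^ n
          ≡⟨ ^-distribʳ-* ρ (s + + 2 * ε) n ⟨
        (ρ * (s + + 2 * ε)) ^ n
          ≈⟨ ^-cong n (begin
               ρ * (s + + 2 * ε)
                 ≡⟨ lem ρ s ε ⟩
               s * ρ + + 2 * ε * ρ
                 ≈⟨ +ʳ (+ 2 * ε * ρ) ρ-root ⟨
               ρ * ρ + 1ℤ + + 2 * ε * ρ
                 ≡⟨ cong (λ z → ρ * ρ + z + + 2 * ε * ρ) ε²≡1 ⟨
               ρ * ρ + ε * ε + + 2 * ε * ρ
                 ≡⟨ lem′ ρ ε ⟩
               (ρ + ε) * (ρ + ε)
                 ∎) ⟩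
        ((ρ + ε) * (ρ + ε)) ^ n
          ≈⟨ square-^n ρ+ε≉0 ⟩
        1ℤ
          ∎) (^n-±1 ρ≉0)
        where
        lem : ∀ ρ s ε → ρ * (s + + 2 * ε) ≡ s * ρ + + 2 * ε * ρ
        lem = solve-∀
        lem′ : ∀ ρ ε → ρ * ρ + ε * ε + + 2 * ε * ρ ≡ (ρ + ε) * (ρ + ε)
        lem′ = solve-∀
      -- At a double root ρ = ± 1 one of s ± 2 is zero.
      shifted-zero : ∀ ε → ε * ε ≡ 1ℤ → ρ + ε ≈ 0ℤ → (s + + 2 * ε) ^ n ≈ 0ℤ
      shifted-zero ε ε²≡1 ρ+ε≈0 = ^-zero k (begin
        s + + 2 * ε
          ≈⟨ +ʳ (+ 2 * ε) (≈-trans s≈ (+-cong ρ≈-ε ρ′≈-ε)) ⟩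
        - ε + - ε + + 2 * ε
          ≡⟨ lem ε ⟩
        0ℤ
          ∎)
        where
        lem : ∀ ε → - ε + - ε + + 2 * ε ≡ 0ℤ
        lem = solve-∀
        lem′ : ∀ ε → - ε * - ε ≡ ε * ε
        lem′ = solve-∀
        lem″ : ∀ ε ρ → ρ ≡ ρ + ε - ε
        lem″ = solve-∀
        ρ≈-ε : ρ ≈ - ε
        ρ≈-ε = ≈-trans (≡⇒≈ (lem″ ε ρ)) (≈-trans (+ʳ (- ε) ρ+ε≈0) (≡⇒≈ (ℤ.+-identityˡ (- ε))))
        ρ′≈-ε : ρ′ ≈ - ε
        ρ′≈-ε = inverse-unique ρ ρρ′≈1 (≈-trans (*ʳ (- ε) ρ≈-ε) (≡⇒≈ (trans (lem′ ε) ε²≡1)))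
      double : ∀ ε → ε * ε ≡ 1ℤ → ρ + ε ≈ 0ℤ → ρ ≈ ρ′
      double ε ε²≡1 ρ+ε≈0 = ≈-sym (inverse-unique ρ ρρ′≈1 (begin
        ρ * ρ
          ≡⟨ lem ρ ε ⟩
        (ρ - ε) * (ρ + ε) + ε * ε
          ≈⟨ +-cong (≈-trans (*ˡ (ρ - ε) ρ+ε≈0) (≡⇒≈ (ℤ.*-zeroʳ (ρ - ε)))) (≡⇒≈ ε²≡1) ⟩
        1ℤ
          ∎))
        where
        lem : ∀ ρ ε → ρ * ρ ≡ (ρ - ε) * (ρ + ε) + ε * ε
        lem = solve-∀
      -- Two distinct roots contribute ρ^n each, and both powers on the right equal ρ^n. A double
      -- root ρ = ±1 contributes once, and exactly one of the powers vanishes.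
      count : Dec (ρ ≈ ρ′) → Dec (ρ + 1ℤ ≈ 0ℤ) → Dec (ρ + -1ℤ ≈ 0ℤ) → ∑ weight ≈ (s + + 2) ^ n + (s - + 2) ^ n
      count (no ρ≉ρ′) _ _ = begin
        ∑ weight
          ≈⟨ ∑-select₂ weight-resp ρ ρ′ ρ≉ρ′ (λ t t≉ρ t≉ρ′ → off t λ t≉0 s≈t →
               [ t≉ρ , t≉ρ′ ]′ (roots t (equation t≉0 s≈t))) ⟩
        weight ρ + weight ρ′
          ≈⟨ +-cong (on ρ s≈) (≈-trans (on ρ′ s≈′) (≈-sym ρ^n-self-inverse)) ⟩
        ρ ^ n + ρ ^ n
          ≈⟨ +-cong (shifted 1ℤ refl (ρ≉ρ′ ∘ double 1ℤ refl)) (shifted -1ℤ refl (ρ≉ρ′ ∘ double -1ℤ refl)) ⟨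
        (s + + 2) ^ n + (s - + 2) ^ n
          ∎
      count (yes ρ≈ρ′) ρ+1 ρ-1 = begin
        ∑ weight
          ≈⟨ ∑-select weight-resp ρ (λ t t≉ρ → off t λ t≉0 s≈t →
               [ t≉ρ , (λ t≈ρ′ → t≉ρ (≈-trans t≈ρ′ (≈-sym ρ≈ρ′))) ]′ (roots t (equation t≉0 s≈t))) ⟩
        weight ρ
          ≈⟨ on ρ s≈ ⟩
        ρ ^ n
          ≈⟨ total ρ+1 ρ-1 ⟨
        (s + + 2) ^ n + (s - + 2) ^ n
          ∎
        where
        ±1 : ρ + 1ℤ ≈ 0ℤ ⊎ ρ + -1ℤ ≈ 0ℤ
        ±1 = *≈0 (ρ + 1ℤ) (ρ + -1ℤ) (≈-trans (≡⇒≈ (lem ρ))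
               (≈⇒-≈0 (≈-trans (*ˡ ρ ρ≈ρ′) ρρ′≈1)))
          where
          lem : ∀ ρ → (ρ + 1ℤ) * (ρ + -1ℤ) ≡ ρ * ρ - 1ℤ
          lem = solve-∀
        total : Dec (ρ + 1ℤ ≈ 0ℤ) → Dec (ρ + -1ℤ ≈ 0ℤ) → (s + + 2) ^ n + (s - + 2) ^ n ≈ ρ ^ n
        total (yes ρ+1≈0) (no ρ-1≉0) =
          ≈-trans (+-cong (shifted-zero 1ℤ refl ρ+1≈0) (shifted -1ℤ refl ρ-1≉0)) (≡⇒≈ (ℤ.+-identityˡ (ρ ^ n)))
        total (no ρ+1≉0) (yes ρ-1≈0) =
          ≈-trans (+-cong (shifted 1ℤ refl ρ+1≉0) (shifted-zero -1ℤ refl ρ-1≈0)) (≡⇒≈ (ℤ.+-identityʳ (ρ ^ n)))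
        total (no ρ+1≉0) (no ρ-1≉0) = ⊥-elim ([ ρ+1≉0 , ρ-1≉0 ]′ ±1)
        total (yes ρ+1≈0) (yes ρ-1≈0) = ⊥-elim (2≉0 (≈-trans (≡⇒≈ (lem ρ)) (+-cong ρ+1≈0 (-‿cong ρ-1≈0))))
          where
          lem : ∀ ρ → + 2 ≡ (ρ + 1ℤ) + - (ρ + -1ℤ)
          lem = solve-∀

    by-cases : Dec (∃ λ (i : Fin p) → rep i * rep i + 1ℤ ≈ s * rep i) → ∑ weight ≈ (s + + 2) ^ n + (s - + 2) ^ n
    by-cases (yes (i , root)) = count (_ ≈? _) (_ ≈? _) (_ ≈? _)
      where open Root (rep i) root
    by-cases (no no-root) = begin
      ∑ weight
        ≈⟨ sum-zero-≈ {p} _ (λ i → off (rep i) λ t≉0 s≈t → no-root (i , equation t≉0 s≈t)) ⟩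
      0ℤ
        -- A² = 1 and A B = -1 give A (A + B) = 0.
        ≈⟨ *-cancelˡ A A≉0 (begin
             A * (A + B)
               ≡⟨ ℤ.*-distribˡ-+ A A B ⟩
             A * A + A * B
               ≈⟨ +-cong (^n-±1 s+2≉0) AB≈-1 ⟩
             0ℤ
               ≡⟨ ℤ.*-zeroʳ A ⟨
             A * 0ℤ
               ∎) ⟨
      A + B
        ∎
      where
      A B h : ℤ
      A = (s + + 2) ^ n
      B = (s - + 2) ^ n
      h = inv (+ 2)
      2h≈1 : + 2 * h ≈ 1ℤ
      2h≈1 = inverseʳ 2≉0
      no-root′ : ∀ t → ¬ t * t + 1ℤ ≈ s * t
      no-root′ t eq = no-root (residue t , (begin
        rep (residue t) * rep (residue t) + 1ℤ
          ≈⟨ +ʳ 1ℤ (*-cong (rep-residue t) (rep-residue t)) ⟩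
        t * t + 1ℤ
          ≈⟨ eq ⟩
        s * t
          ≈⟨ *ˡ s (rep-residue t) ⟨
        s * rep (residue t)
          ∎))
      AB≈-1 : A * B ≈ -1ℤ
      AB≈-1 = ≈-trans (≡⇒≈ (sym (^-distribʳ-* (s + + 2) (s - + 2) n)))
        (nonsquare⇒^n≈-1 ((s + + 2) * (s - + 2)) λ x x²≈ →
          -- The quadratic formula: x is a square root of the discriminant s² - 4 and h is one half.
          -- The factor 4 clears the denominators.
          no-root′ ((s + x) * h) (*-cancelˡ (+ 4) (*-nonzero {+ 2} {+ 2} 2≉0 2≉0) (begin
            + 4 * ((s + x) * h * ((s + x) * h) + 1ℤ)
              ≡⟨ lem₁ s x h ⟩
            (s + x) * (s + x) * (+ 2 * h) * (+ 2 * h) + + 4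
              ≈⟨ +ʳ (+ 4) (*-cong (*ˡ ((s + x) * (s + x)) 2h≈1) 2h≈1) ⟩
            (s + x) * (s + x) * 1ℤ * 1ℤ + + 4
              ≡⟨ lem₂ s x ⟩
            + 2 * s * (s + x) * 1ℤ + (x * x - (s + + 2) * (s - + 2))
              ≈⟨ +-cong (*ˡ (+ 2 * s * (s + x)) (≈-sym 2h≈1)) (≈⇒-≈0 x²≈) ⟩
            + 2 * s * (s + x) * (+ 2 * h) + 0ℤ
              ≡⟨ lem₃ s x h ⟩
            + 4 * (s * ((s + x) * h))
              ∎)))
        where
        lem₁ : ∀ s x h → + 4 * ((s + x) * h * ((s + x) * h) + 1ℤ)
             ≡ (s + x) * (s + x) * (+ 2 * h) * (+ 2 * h) + + 4
        lem₁ = solve-∀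
        lem₂ : ∀ s x → (s + x) * (s + x) * 1ℤ * 1ℤ + + 4
             ≡ + 2 * s * (s + x) * 1ℤ + (x * x - (s + + 2) * (s - + 2))
        lem₂ = solve-∀
        lem₃ : ∀ s x h → + 2 * s * (s + x) * (+ 2 * h) + 0ℤ ≡ + 4 * (s * ((s + x) * h))
        lem₃ = solve-∀
      s+2≉0 : ¬ s + + 2 ≈ 0ℤ
      s+2≉0 s+2≈0 = 1≉0 (≈-trans (-‿cong (≈-sym AB≈-1)) (-‿cong (*ʳ B (^-zero k s+2≈0))))
      A≉0 : ¬ A ≈ 0ℤ
      A≉0 = ^-nonzero n s+2≉0

  -- Evaluation of T 0 and T n

  -- A Jacobi-type sum of the quadratic character and inversion. It is the constant common to T 0
  -- and T n, into which c enters only through powers and linear factors.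
  κ : ℤ
  κ = ∑ λ s → s ^ n * (s + 1ℤ) ^ r

  -- The substitution s ↦ v s brings out v^n · v⁻¹ = v^k.
  κ-scale : ∀ v → ¬ v ≈ 0ℤ → ∑ (λ s → s ^ n * (s + v) ^ r) ≈ v ^ k * κ
  κ-scale v v≉0 = begin
    ∑ F
      ≈⟨ ∑-scale F-resp v≉0 ⟩
    ∑ (λ s → (v * s) ^ n * (v * s + v) ^ r)
      ≈⟨ ∑-cong (λ s → begin
           (v * s) ^ n * (v * s + v) ^ r
             ≡⟨ cong₂ _*_ (^-distribʳ-* v s n)
                  (trans (cong (_^ r) (lem₁ v s)) (^-distribʳ-* v (s + 1ℤ) r)) ⟩
           v * v ^ k * s ^ n * (v ^ r * (s + 1ℤ) ^ r)
             ≡⟨ lem₂ v (v ^ k) (s ^ n) (v ^ r) ((s + 1ℤ) ^ r) ⟩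
           v * v ^ r * (v ^ k * (s ^ n * (s + 1ℤ) ^ r))
             ≈⟨ *ʳ (v ^ k * (s ^ n * (s + 1ℤ) ^ r)) (inverseʳ v≉0) ⟩
           1ℤ * (v ^ k * (s ^ n * (s + 1ℤ) ^ r))
             ≡⟨ ℤ.*-identityˡ (v ^ k * (s ^ n * (s + 1ℤ) ^ r)) ⟩
           v ^ k * (s ^ n * (s + 1ℤ) ^ r)
             ∎) ⟩
    ∑ (λ s → v ^ k * (s ^ n * (s + 1ℤ) ^ r))
      ≈⟨ ∑-*ˡ (v ^ k) (λ s → s ^ n * (s + 1ℤ) ^ r) ⟩
    v ^ k * κ
      ∎
    where
    open ≈-Reasoning
    F : ℤ → ℤ
    F s = s ^ n * (s + v) ^ r
    F-resp : Respectful F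
    F-resp s≈t = *-cong (^-cong n s≈t) (^-cong r (+ʳ v s≈t))
    lem₁ : ∀ v s → v * s + v ≡ v * (s + 1ℤ)
    lem₁ = solve-∀
    lem₂ : ∀ v a s b c → v * a * s * (b * c) ≡ v * b * (a * (s * c))
    lem₂ = solve-∀

  ∑-inverse : ∀ v → ∑ (λ y → (y + v) ^ r) ≈ 0ℤ
  ∑-inverse v = ≈-trans (≈-sym (∑-shift v (^-cong r)))
    (≈-trans (∑-cong λ x → ≡⇒≈ (cong (x ^_) r≡))
             (power-sum (subst (k ℕ.+ k ℕ.<_) (sym r≡) (ℕ.n<1+n (k ℕ.+ k)))))

  -- A residue y is a square 1 + y^n times. The constant part sums to 0 by `∑-inverse`, and the
  -- character part is `κ-scale`.
  ∑-quadratic : ∀ v → ¬ v ≈ 0ℤ → ∑ (λ u → (u * u + v) ^ r) ≈ v ^ k * κ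
  ∑-quadratic v v≉0 = begin
    ∑ (λ u → (u * u + v) ^ r)
      ≈⟨ ∑-squares (λ y → (y + v) ^ r) (λ y≈z → ^-cong r (+ʳ v y≈z)) ⟩
    ∑ (λ y → (y + v) ^ r * (1ℤ + y ^ n))
      ≈⟨ ∑-cong (λ y → ≡⇒≈ (lem ((y + v) ^ r) (y ^ n))) ⟩
    ∑ (λ y → (y + v) ^ r + y ^ n * (y + v) ^ r)
      ≈⟨ ∑-distrib-+′ (λ y → (y + v) ^ r) (λ y → y ^ n * (y + v) ^ r) ⟩
    ∑ (λ y → (y + v) ^ r) + ∑ (λ y → y ^ n * (y + v) ^ r)
      ≈⟨ +-cong (∑-inverse v) (κ-scale v v≉0) ⟩
    0ℤ + v ^ k * κ
      ≡⟨ ℤ.+-identityˡ (v ^ k * κ) ⟩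
    v ^ k * κ
      ∎
    where
    open ≈-Reasoning
    lem : ∀ a b → a * (1ℤ + b) ≡ a + b * a
    lem = solve-∀

  ∑-odd : ∀ {F} → Respectful F → (∀ x → F (- x) ≡ - F x) → ∑ F ≈ 0ℤ
  ∑-odd {F} F-resp F-odd = x≈-x⇒x≈0 (begin
    ∑ F
      ≈⟨ ∑-reindex F-resp -‿cong -‿cong (λ x → ≡⇒≈ (ℤ.neg-involutive x)) (λ x → ≡⇒≈ (ℤ.neg-involutive x)) ⟩
    ∑ (λ x → F (- x))
      ≈⟨ ∑-cong (λ x → ≡⇒≈ (trans (F-odd x) (sym (ℤ.-1*i≡-i (F x))))) ⟩
    ∑ (λ x → -1ℤ * F x)
      ≈⟨ ∑-*ˡ -1ℤ F ⟩
    -1ℤ * ∑ F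
      ≡⟨ ℤ.-1*i≡-i (∑ F) ⟩
    - ∑ F
      ∎)
    where open ≈-Reasoning

  -- Completing the square: 4 (t² + c t + 1) = (2 t + c)² - (c² - 4).
  T-zero : ∀ c v → v ≡ - ((c - + 2) * (c + + 2)) → ¬ v ≈ 0ℤ →
           + 2 * (+ 4) ^ r * T c 1ℤ 0 ≈ - c * (v ^ k * κ)
  T-zero c v v≡ v≉0 = begin
    + 2 * (+ 4) ^ r * T c 1ℤ 0
      ≈⟨ ∑-*ˡ (+ 2 * (+ 4) ^ r) (λ t → quad c 1ℤ t ^ r * t ^ 1) ⟨
    ∑ (λ t → + 2 * (+ 4) ^ r * (quad c 1ℤ t ^ r * (t * 1ℤ)))
      ≈⟨ ∑-cong (λ t → ≡⇒≈ (pointwise t)) ⟩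
    ∑ (λ t → F (+ 2 * t + c))
      ≈⟨ ∑-scale {λ x → F (x + c)} (λ x≈y → F-resp (+ʳ c x≈y)) 2≉0 ⟨
    ∑ (λ x → F (x + c))
      ≈⟨ ∑-shift c F-resp ⟨
    ∑ F
      -- The factor 2 t of T 0 has become u - c with u = 2 t + c; its u part is odd and sums to 0,
      -- so only - c survives.
      ≈⟨ ∑-cong (λ u → ≡⇒≈ (lem₃ ((u * u + v) ^ r) u c)) ⟩
    ∑ (λ u → (u * u + v) ^ r * u + - c * (u * u + v) ^ r)
      ≈⟨ ∑-distrib-+′ (λ u → (u * u + v) ^ r * u) (λ u → - c * (u * u + v) ^ r) ⟩
    ∑ (λ u → (u * u + v) ^ r * u) + ∑ (λ u → - c * (u * u + v) ^ r)
      ≈⟨ +-cong (∑-odd odd-resp odd) (≈-trans (∑-*ˡ (- c) (λ u → (u * u + v) ^ r)) (*ˡ (- c) (∑-quadratic v v≉0))) ⟩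
    0ℤ + - c * (v ^ k * κ)
      ≡⟨ ℤ.+-identityˡ (- c * (v ^ k * κ)) ⟩
    - c * (v ^ k * κ)
      ∎
    where
    open ≈-Reasoning
    F : ℤ → ℤ
    F u = (u * u + v) ^ r * (u - c)
    even-resp : Respectful λ u → (u * u + v) ^ r
    even-resp x≈y = ^-cong r (+ʳ v (*-cong x≈y x≈y))
    F-resp : Respectful F
    F-resp x≈y = *-cong (even-resp x≈y) (+ʳ (- c) x≈y)
    odd-resp : Respectful λ u → (u * u + v) ^ r * u
    odd-resp x≈y = *-cong (even-resp x≈y) x≈y
    odd : ∀ u → (- u * - u + v) ^ r * - u ≡ - ((u * u + v) ^ r * u)
    odd u = trans (cong (λ z → (z + v) ^ r * - u) (lem₁ u)) (lem₂ ((u * u + v) ^ r) u)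
      where
      lem₁ : ∀ u → - u * - u ≡ u * u
      lem₁ = solve-∀
      lem₂ : ∀ a u → a * - u ≡ - (a * u)
      lem₂ = solve-∀
    lem₃ : ∀ a u c → a * (u - c) ≡ a * u + - c * a
    lem₃ = solve-∀
    pointwise : ∀ t → + 2 * (+ 4) ^ r * (quad c 1ℤ t ^ r * (t * 1ℤ)) ≡ F (+ 2 * t + c)
    pointwise t = trans (lem₄ ((+ 4) ^ r) (quad c 1ℤ t ^ r) t c)
      (cong (_* (+ 2 * t + c - c)) (trans (sym (^-distribʳ-* (+ 4) (quad c 1ℤ t) r))
        (cong (_^ r) (trans (lem₅ t c) (cong (λ w → (+ 2 * t + c) * (+ 2 * t + c) + w) (sym v≡))))))
      where
      lem₄ : ∀ f q t c → + 2 * f * (q * (t * 1ℤ)) ≡ f * q * (+ 2 * t + c - c)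
      lem₄ = solve-∀
      lem₅ : ∀ t c → + 4 * (t * t + c * t + 1ℤ)
           ≡ (+ 2 * t + c) * (+ 2 * t + c) + - ((c - + 2) * (c + + 2))
      lem₅ = solve-∀

  -- Each of the two powers in `sym-sum-count` gives a sum over s. As s + c = (s ± 2) + (c ∓ 2), a
  -- shift turns it into `κ-scale` at c ∓ 2.
  T-middle : ∀ c → ¬ c - + 2 ≈ 0ℤ → ¬ c + + 2 ≈ 0ℤ →
             T c 1ℤ n ≈ ((c - + 2) ^ k + (c + + 2) ^ k) * κ
  T-middle c α≉0 β≉0 = begin
    T c 1ℤ n
      ≈⟨ T-suc c k ⟩
    ∑ (λ t → t ^ n * F (sym-sum t))
      ≈⟨ ∑-fibre (_^ n) sym-sum F F-resp ⟩
    ∑ (λ s → F s * ∑ (λ t → t ^ n * δ (s - sym-sum t)))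
      ≈⟨ ∑-cong (λ s → ≈-trans (*ˡ (F s) (sym-sum-count s)) (≡⇒≈ (lem₁ (F s) ((s + + 2) ^ n) ((s - + 2) ^ n)))) ⟩
    ∑ (λ s → (s + + 2) ^ n * F s + (s - + 2) ^ n * F s)
      ≈⟨ ∑-distrib-+′ (λ s → (s + + 2) ^ n * F s) (λ s → (s - + 2) ^ n * F s) ⟩
    ∑ (λ s → (s + + 2) ^ n * F s) + ∑ (λ s → (s - + 2) ^ n * F s)
      ≈⟨ +-cong (one-side (+ 2) α≉0) (one-side (- + 2) β≉0) ⟩
    (c - + 2) ^ k * κ + (c + + 2) ^ k * κ
      ≡⟨ ℤ.*-distribʳ-+ κ ((c - + 2) ^ k) ((c + + 2) ^ k) ⟨
    ((c - + 2) ^ k + (c + + 2) ^ k) * κ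
      ∎
    where
    open ≈-Reasoning
    F : ℤ → ℤ
    F s = (s + c) ^ r
    F-resp : Respectful F
    F-resp s≈t = ^-cong r (+ʳ c s≈t)
    lem₁ : ∀ f a b → f * (a + b) ≡ a * f + b * f
    lem₁ = solve-∀
    one-side : ∀ e → ¬ c - e ≈ 0ℤ → ∑ (λ s → (s + e) ^ n * F s) ≈ (c - e) ^ k * κ
    one-side e c-e≉0 = begin
      ∑ (λ s → (s + e) ^ n * F s)
        ≈⟨ ∑-cong (λ s → ≡⇒≈ (cong (λ z → (s + e) ^ n * z ^ r) (lem₂ s e c))) ⟩
      ∑ (λ s → (s + e) ^ n * (s + e + (c - e)) ^ r)
        ≈⟨ ∑-shift {λ x → x ^ n * (x + (c - e)) ^ r} e
             (λ x≈y → *-cong (^-cong n x≈y) (^-cong r (+ʳ (c - e) x≈y))) ⟨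
      ∑ (λ x → x ^ n * (x + (c - e)) ^ r)
        ≈⟨ κ-scale (c - e) c-e≉0 ⟩
      (c - e) ^ k * κ
        ∎
      where
      lem₂ : ∀ s e c → s + c ≡ s + e + (c - e)
      lem₂ = solve-∀

  -- The n-th power of det D for b = 1

  module _ (c : ℤ) (det≉0 : ¬ det (D p c 1ℤ) ≈ 0ℤ) where
    private
      α β P u : ℤ
      α = c - + 2
      β = c + + 2
      P = T c 1ℤ 0 * T c 1ℤ n
      -- The square u² supplies the factor 4^r demanded by `T-zero`, and one α β for each of T 0 and
      -- T n, raising their k-th powers to n-th powers.
      u = (+ 2) ^ r * (α * β)

      R : ℤ
      R = proj₁ (det-D-square-class c)

      det≈ : det (D p c 1ℤ) ≈ R * R * P
      det≈ = proj₂ (det-D-square-class c)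

      R≉0 : ¬ R ≈ 0ℤ
      R≉0 R≈0 = det≉0 (≈-trans det≈ (*ʳ P (*ʳ R R≈0)))

      P≉0 : ¬ P ≈ 0ℤ
      P≉0 P≈0 = det≉0 (≈-trans det≈ (≈-trans (*ˡ (R * R) P≈0) (≡⇒≈ (ℤ.*-zeroʳ (R * R)))))

      det^n : det (D p c 1ℤ) ^ n ≈ P ^ n
      det^n = begin
        det (D p c 1ℤ) ^ n
          ≈⟨ ^-cong n det≈ ⟩
        (R * R * P) ^ n
          ≡⟨ ^-distribʳ-* (R * R) P n ⟩
        (R * R) ^ n * P ^ n
          ≈⟨ *ʳ (P ^ n) (square-^n R≉0) ⟩
        1ℤ * P ^ n
          ≡⟨ ℤ.*-identityˡ (P ^ n) ⟩
        P ^ n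
          ∎
        where open ≈-Reasoning

    module _ (α≉0 : ¬ α ≈ 0ℤ) (β≉0 : ¬ β ≈ 0ℤ) where
      private
        product : - + 2 * (u * u * P) ≈ - c * (κ * κ) * (α ^ n * (- β) ^ n) * (α ^ n * β + β ^ n * α)
        product = begin
          - + 2 * (u * u * P)
            ≡⟨ lem₁ ((+ 2) ^ r) α β (T c 1ℤ 0) (T c 1ℤ n) ⟩
          + 2 * ((+ 2) ^ r * (+ 2) ^ r) * T c 1ℤ 0 * (α * (- β)) * (α * β * T c 1ℤ n)
            ≡⟨ cong (λ z → + 2 * z * T c 1ℤ 0 * (α * (- β)) * (α * β * T c 1ℤ n)) (^-distribʳ-* (+ 2) (+ 2) r) ⟨
          + 2 * (+ 4) ^ r * T c 1ℤ 0 * (α * (- β)) * (α * β * T c 1ℤ n)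
            ≈⟨ *-cong (*ʳ (α * (- β)) (T-zero c (α * (- β)) (lem₂ α β) -Δ≉0)) (*ˡ (α * β) (T-middle c α≉0 β≉0)) ⟩
          - c * ((α * (- β)) ^ k * κ) * (α * (- β)) * (α * β * ((α ^ k + β ^ k) * κ))
            ≡⟨ lem₃ c ((α * (- β)) ^ k) κ (α * (- β)) α β (α ^ k) (β ^ k) ⟩
          - c * (κ * κ) * (α * (- β)) ^ n * (α ^ n * β + β ^ n * α)
            ≡⟨ cong (λ z → - c * (κ * κ) * z * (α ^ n * β + β ^ n * α)) (^-distribʳ-* α (- β) n) ⟩
          - c * (κ * κ) * (α ^ n * (- β) ^ n) * (α ^ n * β + β ^ n * α)
            ∎
          where
          open ≈-Reasoning
          -Δ≉0 : ¬ α * (- β) ≈ 0ℤ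
          -Δ≉0 = *-nonzero α≉0 (λ eq → β≉0 (≈-trans (≡⇒≈ (sym (ℤ.neg-involutive β))) (-‿cong eq)))
          lem₁ : ∀ w α β t t′ → - + 2 * (w * (α * β) * (w * (α * β)) * (t * t′))
               ≡ + 2 * (w * w) * t * (α * (- β)) * (α * β * t′)
          lem₁ = solve-∀
          lem₂ : ∀ α β → α * (- β) ≡ - (α * β)
          lem₂ = solve-∀
          lem₃ : ∀ c d κ v α β a b → - c * (d * κ) * v * (α * β * ((a + b) * κ))
               ≡ - c * (κ * κ) * (v * d) * (α * a * β + β * b * α)
          lem₃ = solve-∀

        n-th-power : ∀ {w z} → ¬ w ≈ 0ℤ → u * u * P ≈ w * w * z → P ^ n ≈ z ^ n
        n-th-power {w} {z} w≉0 eq = begin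
          P ^ n
            ≡⟨ ℤ.*-identityˡ (P ^ n) ⟨
          1ℤ * P ^ n
            ≈⟨ *ʳ (P ^ n) (square-^n (*-nonzero (^-nonzero r 2≉0) (*-nonzero α≉0 β≉0))) ⟨
          (u * u) ^ n * P ^ n
            ≡⟨ ^-distribʳ-* (u * u) P n ⟨
          (u * u * P) ^ n
            ≈⟨ ^-cong n eq ⟩
          (w * w * z) ^ n
            ≡⟨ ^-distribʳ-* (w * w) z n ⟩
          (w * w) ^ n * z ^ n
            ≈⟨ *ʳ (z ^ n) (square-^n w≉0) ⟩
          1ℤ * z ^ n
            ≡⟨ ℤ.*-identityˡ (z ^ n) ⟩
          z ^ n
            ∎
          where open ≈-Reasoning

        -- Here the hypothesis on det reaches κ: with w = c κ or w = κ below, the square factor to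
        -- be discarded is nonzero.
        square≉0 : ∀ {w z} → u * u * P ≈ w * w * z → ¬ w ≈ 0ℤ
        square≉0 {w} {z} eq w≈0 = *-nonzero (*-nonzero u≉0 u≉0) P≉0 (≈-trans eq (*ʳ z (*ʳ w w≈0)))
          where
          u≉0 : ¬ u ≈ 0ℤ
          u≉0 = *-nonzero (^-nonzero r 2≉0) (*-nonzero α≉0 β≉0)

        -2≉0 : ¬ - + 2 ≈ 0ℤ
        -2≉0 eq = 2≉0 (-‿cong eq)

      -- With α^n = β^n the bracket in `product` is α^n (α + β) = 2 c α^n, so c joins κ in the
      -- square.
      det^n-split : α ^ n ≈ β ^ n → det (D p c 1ℤ) ^ n ≈ ((- β) ^ n) ^ n
      det^n-split α^n≈β^n = ≈-trans det^n (n-th-power (square≉0 {c * κ} key) key)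
        where
        open ≈-Reasoning
        key : u * u * P ≈ c * κ * (c * κ) * (- β) ^ n
        key = *-cancelˡ (- + 2) -2≉0 (begin
          - + 2 * (u * u * P)
            ≈⟨ product ⟩
          - c * (κ * κ) * (α ^ n * (- β) ^ n) * (α ^ n * β + β ^ n * α)
            ≈⟨ *ˡ (- c * (κ * κ) * (α ^ n * (- β) ^ n)) (+ˡ (α ^ n * β) (*ʳ α (≈-sym α^n≈β^n))) ⟩
          - c * (κ * κ) * (α ^ n * (- β) ^ n) * (α ^ n * β + α ^ n * α)
            ≡⟨ lem c κ (α ^ n) ((- β) ^ n) ⟩
          α ^ n * α ^ n * (- + 2 * (c * κ * (c * κ) * (- β) ^ n))
            ≈⟨ *ʳ (- + 2 * (c * κ * (c * κ) * (- β) ^ n)) (^n-±1 α≉0) ⟩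
          1ℤ * (- + 2 * (c * κ * (c * κ) * (- β) ^ n))
            ≡⟨ ℤ.*-identityˡ (- + 2 * (c * κ * (c * κ) * (- β) ^ n)) ⟩
          - + 2 * (c * κ * (c * κ) * (- β) ^ n)
            ∎)
          where
          lem : ∀ c κ a b → - c * (κ * κ) * (a * b) * (a * (c + + 2) + a * (c - + 2))
              ≡ a * a * (- + 2 * (c * κ * (c * κ) * b))
          lem = solve-∀

      -- With α^n = - β^n the bracket is - β^n (β - α) = - 4 β^n. The factor c therefore occurs only
      -- once, and after division by -2 it stands as 2 c.
      det^n-inert : α ^ n ≈ - β ^ n → det (D p c 1ℤ) ^ n ≈ ((- β) ^ n * (+ 2 * c)) ^ n
      det^n-inert α^n≈-β^n = ≈-trans det^n (n-th-power (square≉0 {κ} key) key)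
        where
        open ≈-Reasoning
        key : u * u * P ≈ κ * κ * ((- β) ^ n * (+ 2 * c))
        key = *-cancelˡ (- + 2) -2≉0 (begin
          - + 2 * (u * u * P)
            ≈⟨ product ⟩
          - c * (κ * κ) * (α ^ n * (- β) ^ n) * (α ^ n * β + β ^ n * α)
            ≈⟨ *-cong (*ˡ (- c * (κ * κ)) (*ʳ ((- β) ^ n) α^n≈-β^n)) (+ʳ (β ^ n * α) (*ʳ β α^n≈-β^n)) ⟩
          - c * (κ * κ) * (- β ^ n * (- β) ^ n) * (- β ^ n * β + β ^ n * α)
            ≡⟨ lem c κ (β ^ n) ((- β) ^ n) ⟩
          β ^ n * β ^ n * (- + 2 * (κ * κ * ((- β) ^ n * (+ 2 * c))))
            ≈⟨ *ʳ (- + 2 * (κ * κ * ((- β) ^ n * (+ 2 * c)))) (^n-±1 β≉0) ⟩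
          1ℤ * (- + 2 * (κ * κ * ((- β) ^ n * (+ 2 * c))))
            ≡⟨ ℤ.*-identityˡ (- + 2 * (κ * κ * ((- β) ^ n * (+ 2 * c)))) ⟩
          - + 2 * (κ * κ * ((- β) ^ n * (+ 2 * c)))
            ∎)
          where
          lem : ∀ c κ a b → - c * (κ * κ) * (- a * b) * (- a * (c + + 2) + a * (c - + 2))
              ≡ a * a * (- + 2 * (κ * κ * (b * (+ 2 * c))))
          lem = solve-∀

  -- Rescaling from b = d² to b = 1

  mirror : ∀ l f c → (∀ i j → suc (i ℕ.+ j) ≡ l ℕ.+ l → f i * f j ≈ c) → prodTo (l ℕ.+ l) f ≈ c ^ l
  mirror ℕ.zero  f c f-pair = ≈-refl
  mirror (suc l) f c f-pair = begin
    f 0 * prodTo (l ℕ.+ suc l) (f ∘ suc)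
      ≡⟨ cong (λ N → f 0 * prodTo N (f ∘ suc)) (ℕ.+-suc l l) ⟩
    f 0 * prodTo (suc (l ℕ.+ l)) (f ∘ suc)
      ≡⟨ cong (f 0 *_) (prodTo-last (l ℕ.+ l) (f ∘ suc)) ⟩
    f 0 * (prodTo (l ℕ.+ l) (f ∘ suc) * f (suc (l ℕ.+ l)))
      ≡⟨ lem (f 0) (prodTo (l ℕ.+ l) (f ∘ suc)) (f (suc (l ℕ.+ l))) ⟩
    f 0 * f (suc (l ℕ.+ l)) * prodTo (l ℕ.+ l) (f ∘ suc)
      ≈⟨ *-cong (f-pair 0 (suc (l ℕ.+ l)) (cong suc (sym (ℕ.+-suc l l))))
           (mirror l (f ∘ suc) c λ i j i+j → f-pair (suc i) (suc j)
             (cong suc (trans (cong suc (ℕ.+-suc i j)) (trans (cong suc i+j) (sym (ℕ.+-suc l l)))))) ⟩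
    c * c ^ l
      ∎
    where
    open ≈-Reasoning
    lem : ∀ a b c → a * (b * c) ≡ a * c * b
    lem = solve-∀

  module _ (c d d⁻¹ : ℤ) (d≉0 : ¬ d ≈ 0ℤ) (dd⁻¹≈1 : d * d⁻¹ ≈ 1ℤ) where
    open ≈-Reasoning

    -- Under t ↦ d t the quadratic gains d², so the factor is d⁻² · d^(m+1) = d⁻¹ · d^m, with d⁻¹
    -- written as d^r.
    T-rescale : ∀ m → T c (d ^ 2) m ≈ d ^ r * d ^ m * T (c * d⁻¹) 1ℤ m
    T-rescale m = begin
      T c (d ^ 2) m
        ≈⟨ ∑-scale {λ t → quad c (d ^ 2) t ^ r * t ^ suc m}
             (λ t≈u → *-cong (^-cong r (quad-resp c (d ^ 2) t≈u)) (^-cong (suc m) t≈u)) d≉0 ⟩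
      ∑ (λ t → quad c (d ^ 2) (d * t) ^ r * (d * t) ^ suc m)
        ≈⟨ ∑-cong pointwise ⟩
      ∑ (λ t → d ^ r * d ^ m * (quad (c * d⁻¹) 1ℤ t ^ r * t ^ suc m))
        ≈⟨ ∑-*ˡ (d ^ r * d ^ m) (λ t → quad (c * d⁻¹) 1ℤ t ^ r * t ^ suc m) ⟩
      d ^ r * d ^ m * T (c * d⁻¹) 1ℤ m
        ∎
      where
      lem₁ : ∀ t c d → d * t * (d * t) + c * (d * t) + d * (d * 1ℤ) ≡ d * d * (t * t + 1ℤ) + c * d * t * 1ℤ
      lem₁ = solve-∀
      lem₂ : ∀ t c d e → d * d * (t * t + 1ℤ) + c * d * t * (d * e) ≡ d * d * (t * t + c * e * t + 1ℤ)
      lem₂ = solve-∀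
      lem₃ : ∀ a q d b s → a * a * q * (d * b * s) ≡ d * a * (a * b * (q * s))
      lem₃ = solve-∀
      pointwise : ∀ t → quad c (d ^ 2) (d * t) ^ r * (d * t) ^ suc m
                ≈ d ^ r * d ^ m * (quad (c * d⁻¹) 1ℤ t ^ r * t ^ suc m)
      pointwise t = begin
        quad c (d ^ 2) (d * t) ^ r * (d * t) ^ suc m
          ≈⟨ *-cong (^-cong r (begin
               quad c (d ^ 2) (d * t)
                 ≡⟨ lem₁ t c d ⟩
               d * d * (t * t + 1ℤ) + c * d * t * 1ℤ
                 ≈⟨ +ˡ (d * d * (t * t + 1ℤ)) (*ˡ (c * d * t) dd⁻¹≈1) ⟨
               d * d * (t * t + 1ℤ) + c * d * t * (d * d⁻¹)
                 ≡⟨ lem₂ t c d d⁻¹ ⟩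
               d * d * quad (c * d⁻¹) 1ℤ t
                 ∎)) (≡⇒≈ (^-distribʳ-* d t (suc m))) ⟩
        (d * d * quad (c * d⁻¹) 1ℤ t) ^ r * (d * d ^ m * t ^ suc m)
          ≡⟨ cong (_* (d * d ^ m * t ^ suc m)) (trans (^-distribʳ-* (d * d) (quad (c * d⁻¹) 1ℤ t) r)
               (cong (_* quad (c * d⁻¹) 1ℤ t ^ r) (^-distribʳ-* d d r))) ⟩
        d ^ r * d ^ r * quad (c * d⁻¹) 1ℤ t ^ r * (d * d ^ m * t ^ suc m)
          ≡⟨ lem₃ (d ^ r) (quad (c * d⁻¹) 1ℤ t ^ r) d (d ^ m) (t ^ suc m) ⟩
        d * d ^ r * (d ^ r * d ^ m * (quad (c * d⁻¹) 1ℤ t ^ r * t ^ suc m))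
          ≈⟨ *ʳ (d ^ r * d ^ m * (quad (c * d⁻¹) 1ℤ t ^ r * t ^ suc m)) (inverseʳ d≉0) ⟩
        1ℤ * (d ^ r * d ^ m * (quad (c * d⁻¹) 1ℤ t ^ r * t ^ suc m))
          ≡⟨ ℤ.*-identityˡ (d ^ r * d ^ m * (quad (c * d⁻¹) 1ℤ t ^ r * t ^ suc m)) ⟩
        d ^ r * d ^ m * (quad (c * d⁻¹) 1ℤ t ^ r * t ^ suc m)
          ∎

    -- The n pairs of exponents with sum r each give d^r = d⁻¹, and d^(-n) = d^n because d^(2n) = 1.
    prod-powers : prodTo (suc r) (d ^_) ≈ d ^ n
    prod-powers = begin
      prodTo (suc r) (d ^_)
        ≈⟨ mirror n (d ^_) (d ^ r) (λ i j i+j → ≡⇒≈ (trans (sym (ℤ.^-distribˡ-+-* d i j))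
             (cong (d ^_) (ℕ.suc-injective i+j)))) ⟩
      (d ^ r) ^ n
        ≈⟨ inverse-unique (d ^ n)
             (≈-trans (≡⇒≈ (sym (^-distribʳ-* d (d ^ r) n)))
               (≈-trans (^-cong n (inverseʳ d≉0)) (≡⇒≈ (ℤ.^-zeroˡ n))))
             (^n-±1 d≉0) ⟩
      d ^ n
        ∎

    det-D-rescale : det (D p c (d ^ 2)) ≈ d ^ n * det (D p (c * d⁻¹) 1ℤ)
    det-D-rescale = begin
      det (D p c (d ^ 2))
        ≈⟨ det-D c (d ^ 2) ⟩
      Q * Q * prodTo (suc r) (T c (d ^ 2))
        ≈⟨ *ˡ (Q * Q) (begin
             prodTo (suc r) (T c (d ^ 2))
               ≈⟨ prod-cong {suc r} (λ m → T-rescale (toℕ m)) ⟩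
             prodTo (suc r) (λ m → d ^ r * d ^ m * T (c * d⁻¹) 1ℤ m)
               ≈⟨ prod-distrib-* {suc r} (λ m → d ^ r * d ^ toℕ m) (λ m → T (c * d⁻¹) 1ℤ (toℕ m)) ⟩
             prodTo (suc r) (λ m → d ^ r * d ^ m) * P
               ≡⟨ cong (_* P) (prod-scale {suc r} (d ^ r) (λ m → d ^ toℕ m)) ⟩
             (d ^ r) ^ suc r * prodTo (suc r) (d ^_) * P
               ≈⟨ *ʳ P (*-cong (fermat (^-nonzero r d≉0)) prod-powers) ⟩
             1ℤ * d ^ n * P
               ≡⟨ cong (_* P) (ℤ.*-identityˡ (d ^ n)) ⟩
             d ^ n * P
               ∎) ⟩
      Q * Q * (d ^ n * P)
        ≡⟨ lem Q (d ^ n) P ⟩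
      d ^ n * (Q * Q * P)
        ≈⟨ *ˡ (d ^ n) (det-D (c * d⁻¹) 1ℤ) ⟨
      d ^ n * det (D p (c * d⁻¹) 1ℤ)
        ∎
      where
      P : ℤ
      P = prodTo (suc r) (T (c * d⁻¹) 1ℤ)
      lem : ∀ q e P → q * q * (e * P) ≡ e * (q * q * P)
      lem = solve-∀

  -- The Legendre symbols

  legendre-ternary : ∀ a → Ternary (legendre p a)
  legendre-ternary a = proj₁ (euler a)

  legendre-≈ : ∀ a → legendre p a ≈ a ^ n
  legendre-≈ a = proj₂ (euler a)

  [p-1]/2≡n : (p ∸ 1) / 2 ≡ n
  [p-1]/2≡n = trans (cong (_/ 2) (trans (sym (cong (n ℕ.+_) (ℕ.+-identityʳ n))) (ℕ.*-comm 2 n))) (m*n/n≡m n 2)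

  module _ (c d : ℤ) (p∤det : ¬ + p ∣ det (D p c 1ℤ)) where
    private
      det≉0 : ¬ det (D p c 1ℤ) ≈ 0ℤ
      det≉0 = p∤det ∘ ≈0⇒∣

      α β : ℤ
      α = c - + 2
      β = c + + 2

      -β≡ : - β ≡ - c - + 2
      -β≡ = lem c
        where
        lem : ∀ c → - (c + + 2) ≡ - c - + 2
        lem = solve-∀

      αβ^n : ∀ {l} → legendre p (c ^ 2 - + 4) ≡ l → α ^ n * β ^ n ≈ l
      αβ^n {l} eq = begin
        α ^ n * β ^ n
          ≡⟨ ^-distribʳ-* α β n ⟨
        (α * β) ^ n
          ≡⟨ cong (_^ n) (lem c) ⟩
        (c ^ 2 - + 4) ^ n
          ≈⟨ legendre-≈ (c ^ 2 - + 4) ⟨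
        legendre p (c ^ 2 - + 4)
          ≡⟨ eq ⟩
        l
          ∎
        where
        open ≈-Reasoning
        lem : ∀ c → (c - + 2) * (c + + 2) ≡ c * (c * 1ℤ) - + 4
        lem = solve-∀

      -- A symbol of c² - 4 equal to ±1 keeps c away from ±2, as the evaluations of T 0 and T n
      -- require.
      α≉0 : ∀ {l} → α ^ n * β ^ n ≈ l → ¬ l ≈ 0ℤ → ¬ α ≈ 0ℤ
      α≉0 eq l≉0 α≈0 = l≉0 (≈-trans (≈-sym eq) (*ʳ (β ^ n) (^-zero k α≈0)))

      β≉0 : ∀ {l} → α ^ n * β ^ n ≈ l → ¬ l ≈ 0ℤ → ¬ β ≈ 0ℤ
      β≉0 eq l≉0 β≈0 = l≉0 (≈-trans (≈-sym eq)
        (≈-trans (*ˡ (α ^ n) (^-zero k β≈0)) (≡⇒≈ (ℤ.*-zeroʳ (α ^ n)))))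

      -1≉0 : ¬ -1ℤ ≈ 0ℤ
      -1≉0 eq = 1≉0 (-‿cong eq)

      -β^n≈ : (- β) ^ n ≈ legendre p (- c - + 2)
      -β^n≈ = ≈-trans (≡⇒≈ (cong (_^ n) -β≡)) (≈-sym (legendre-≈ (- c - + 2)))

    split : legendre p (c ^ 2 - + 4) ≡ 1ℤ →
            legendre p (det (D p c 1ℤ)) ≡ legendre p (- c - + 2) ^ n
    split eq = Ternary-≈⇒≡ (legendre-ternary (det (D p c 1ℤ)))
      (Ternary-^ n (legendre-ternary (- c - + 2))) (begin
      legendre p (det (D p c 1ℤ))
        ≈⟨ legendre-≈ (det (D p c 1ℤ)) ⟩
      det (D p c 1ℤ) ^ n
        ≈⟨ det^n-split c det≉0 (α≉0 (αβ^n eq) 1≉0) β≉0′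
             -- Both α^n and β^n are inverse to β^n.
             (inverse-unique (β ^ n) {α ^ n} {β ^ n} (≈-trans (≡⇒≈ (ℤ.*-comm (β ^ n) (α ^ n))) (αβ^n eq)) (^n-±1 β≉0′)) ⟩
      ((- β) ^ n) ^ n
        ≈⟨ ^-cong n -β^n≈ ⟩
      legendre p (- c - + 2) ^ n
        ∎)
      where
      open ≈-Reasoning
      β≉0′ : ¬ β ≈ 0ℤ
      β≉0′ = β≉0 (αβ^n eq) 1≉0

    inert : legendre p (c ^ 2 - + 4) ≡ -1ℤ →
            legendre p (det (D p c 1ℤ)) ≡ legendre p (- c - + 2) ^ n * legendre p (+ 2 * c)
    inert eq = Ternary-≈⇒≡ (legendre-ternary (det (D p c 1ℤ)))
      (Ternary-* (Ternary-^ n (legendre-ternary (- c - + 2))) (legendre-ternary (+ 2 * c))) (begin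
      legendre p (det (D p c 1ℤ))
        ≈⟨ legendre-≈ (det (D p c 1ℤ)) ⟩
      det (D p c 1ℤ) ^ n
        ≈⟨ det^n-inert c det≉0 (α≉0 (αβ^n eq) -1≉0) β≉0′ α^n≈-β^n ⟩
      ((- β) ^ n * (+ 2 * c)) ^ n
        ≡⟨ ^-distribʳ-* ((- β) ^ n) (+ 2 * c) n ⟩
      ((- β) ^ n) ^ n * (+ 2 * c) ^ n
        ≈⟨ *-cong (^-cong n -β^n≈) (≈-sym (legendre-≈ (+ 2 * c))) ⟩
      legendre p (- c - + 2) ^ n * legendre p (+ 2 * c)
        ∎)
      where
      open ≈-Reasoning
      β≉0′ : ¬ β ≈ 0ℤ
      β≉0′ = β≉0 (αβ^n eq) -1≉0
      lem : ∀ a b → b * - a ≡ - (a * b)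
      lem = solve-∀
      α^n≈-β^n : α ^ n ≈ - β ^ n
      α^n≈-β^n = ≈-trans (≡⇒≈ (sym (ℤ.neg-involutive (α ^ n)))) (-‿cong
        -- Both - α^n and β^n are inverse to β^n.
        (inverse-unique (β ^ n) (≈-trans (≡⇒≈ (lem (α ^ n) (β ^ n))) (-‿cong (αβ^n eq))) (^n-±1 β≉0′)))

    rescale : ¬ (+ p ∣ d) → (d⁻¹ : ℤ) → d * d⁻¹ ≡ 1ℤ [mod p ] →
              legendre p (det (D p c (d ^ 2))) ≡ legendre p d ^ n * legendre p (det (D p (c * d⁻¹) 1ℤ))
    rescale p∤d d⁻¹ dd⁻¹≡1 = Ternary-≈⇒≡ (legendre-ternary (det (D p c (d ^ 2))))
      (Ternary-* (Ternary-^ n (legendre-ternary d)) (legendre-ternary (det (D p (c * d⁻¹) 1ℤ)))) (begin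
      legendre p (det (D p c (d ^ 2)))
        ≈⟨ legendre-≈ (det (D p c (d ^ 2))) ⟩
      det (D p c (d ^ 2)) ^ n
        ≈⟨ ^-cong n (det-D-rescale c d d⁻¹ (p∤d ∘ ≈0⇒∣) (mod dd⁻¹≡1)) ⟩
      (d ^ n * det (D p (c * d⁻¹) 1ℤ)) ^ n
        ≡⟨ ^-distribʳ-* (d ^ n) (det (D p (c * d⁻¹) 1ℤ)) n ⟩
      (d ^ n) ^ n * det (D p (c * d⁻¹) 1ℤ) ^ n
        ≈⟨ *-cong (^-cong n (legendre-≈ d)) (legendre-≈ (det (D p (c * d⁻¹) 1ℤ))) ⟨
      legendre p d ^ n * legendre p (det (D p (c * d⁻¹) 1ℤ))
        ∎)
      where open ≈-Reasoning

    corollary1-suc :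
      (legendre p (c ^ 2 - + 4) ≡ 1ℤ →
        legendre p (det (D p c 1ℤ)) ≡ legendre p (- c - + 2) ^ ((p ∸ 1) / 2))
      ×
      (legendre p (c ^ 2 - + 4) ≡ -1ℤ →
        legendre p (det (D p c 1ℤ)) ≡ legendre p (- c - + 2) ^ ((p ∸ 1) / 2) * legendre p (+ 2 * c))
      ×
      (¬ (+ p ∣ d) → (d⁻¹ : ℤ) → d * d⁻¹ ≡ 1ℤ [mod p ] →
        legendre p (det (D p c (d ^ 2)))
          ≡ legendre p d ^ ((p ∸ 1) / 2) * legendre p (det (D p (c * d⁻¹) 1ℤ)))
    corollary1-suc =
      (λ eq → trans (split eq) (cong (legendre p (- c - + 2) ^_) n≡)) ,
      (λ eq → trans (inert eq) (cong (λ m → legendre p (- c - + 2) ^ m * legendre p (+ 2 * c)) n≡)) ,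
      (λ p∤d d⁻¹ dd⁻¹≡1 → trans (rescale p∤d d⁻¹ dd⁻¹≡1)
        (cong (λ m → legendre p d ^ m * legendre p (det (D p (c * d⁻¹) 1ℤ))) n≡))
      where
      n≡ : n ≡ (p ∸ 1) / 2
      n≡ = sym [p-1]/2≡n

-- Reduction of the theorem to p = 2 k + 3

odd-prime : ∀ {p} → Prime p → ¬ 2 ∣ₙ p → ∃ λ k → p ≡ suc (suc k ℕ.+ suc k)
odd-prime {p} isPrime odd = by-quotient (p / 2) (by-remainder (p % 2) refl (m%n<n p 2))
  where
  by-remainder : ∀ m → m ≡ p % 2 → m ℕ.< 2 → p ≡ suc (p / 2 ℕ.* 2)
  by-remainder 0 eq _ = ⊥-elim (odd (m%n≡0⇒n∣m p 2 (sym eq)))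
  by-remainder 1 eq _ = trans (m≡m%n+[m/n]*n p 2) (cong (ℕ._+ p / 2 ℕ.* 2) (sym eq))
  by-remainder (suc (suc _)) _ (s≤s (s≤s ()))
  by-quotient : ∀ q → p ≡ suc (q ℕ.* 2) → ∃ λ k → p ≡ suc (suc k ℕ.+ suc k)
  by-quotient 0       eq = ⊥-elim (¬prime[1] (subst Prime eq isPrime))
  by-quotient (suc k) eq = k , trans eq (cong suc
    (trans (ℕ.*-comm (suc k) 2) (cong (suc k ℕ.+_) (ℕ.+-identityʳ (suc k)))))

corollary1 : (p : ℕ) → Prime p → ¬ (2 ∣ₙ p) →
    (c d : ℤ) →
    ¬ (+ p ∣ det (D p c 1ℤ)) →
    (legendre p (c ^ 2 - + 4) ≡ 1ℤ →
    legendre p (det (D p c 1ℤ)) ≡ legendre p (- c - + 2) ^ ((p ∸ 1) / 2))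
    ×
    (legendre p (c ^ 2 - + 4) ≡ -1ℤ →
    legendre p (det (D p c 1ℤ))
    ≡ legendre p (- c - + 2) ^ ((p ∸ 1) / 2) * legendre p (+ 2 * c))
    ×
    (¬ (+ p ∣ d) → (d⁻¹ : ℤ) → d * d⁻¹ ≡ 1ℤ [mod p ] →
    legendre p (det (D p c (d ^ 2)))
    ≡ legendre p d ^ ((p ∸ 1) / 2) * legendre p (det (D p (c * d⁻¹) 1ℤ)))
corollary1 p isPrime odd with odd-prime isPrime odd
... | k , refl = OddPrime.corollary1-suc k isPrime
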